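{- Let $A,B,C\in\mathbb{Z}$ and $F(x,y)=Ax^4+Bx^2y^2+Cy^4$. (a) For an odd prime $p$, $Q_F$ is maximal at $p$ if and only if $p$ does not divide all of $A,B,C$, and $A,C,B^2-4AC\not\equiv 0\pmod{p^2}$. (b) $Q_F$ is maximal at $2$ if and only if $A,B,C$ are not all even, $A,C\not\equiv0\pmod 4$, and: $A+B+C\not\equiv 0\pmod 4$ when one of $A,B,C$ is even; $A+B\equiv0\pmod4$ or $B+C\equiv0\pmod 4$ when $A,B,C$ are all odd.
   Context: For an integral binary quartic form $F=a_4x^4+a_3x^3y+a_2x^2y^2+a_1xy^3+a_0y^4$, $Q_F$ is the quartic ring associated to $F$ by Birch–Merriman/Nakagawa (equivalently, by Wood, the quartic ring corresponding under Bhargava's parametrization to the pair of ternary quadratic forms $(U_0,V_F)$ with $U_0=-xy+z^2$, $V_F=a_0x^2+a_4y^2+a_2z^2+a_1xz+a_3yz$); as a $\mathbb{Z}$-module it has basis $1,\zeta_1,\zeta_2,\zeta_3$ and, when $F$ is irreducible and $\theta$ is a root of $F(x,1)$, $\zeta_1=a_4\theta$, $\zeta_2=a_4\theta^2+a_3\theta$, $\zeta_3=a_4\theta^3+a_3\theta^2+a_2\theta$. $Q_F$ is maximal at a prime $p$ if $\mathbb{Z}_p\otimes_{\mathbb{Z}}Q_F$ is a maximal quartic ring over $\mathbb{Z}_p$. -}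

module Defs where

open import Data.Nat using (ℕ; _^_)
open import Data.Integer using (ℤ; +_; _+_; _*_; -_; 0ℤ; 1ℤ)
open import Data.Product using (Σ; _×_; ∃)
open import Relation.Binary.PropositionalEquality using (_≡_)
open import Relation.Nullary using (¬_)

-- An integral binary quartic form
--   F = a4 x^4 + a3 x^3 y + a2 x^2 y^2 + a1 x y^3 + a0 y^4
record BQF : Set where
  constructor bqf
  field
    a4 a3 a2 a1 a0 : ℤ

-- An element  e0 + e1 ζ1 + e2 ζ2 + e3 ζ3  of Q_F (coordinates in the basis 1, ζ1, ζ2, ζ3).
record El : Set where
  constructor el
  field
    e0 e1 e2 e3 : ℤ

open El

_⊕_ : El → El → El
el x0 x1 x2 x3 ⊕ el y0 y1 y2 y3 = el (x0 + y0) (x1 + y1) (x2 + y2) (x3 + y3)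

⊖_ : El → El
⊖ el x0 x1 x2 x3 = el (- x0) (- x1) (- x2) (- x3)

zeroEl : El
zeroEl = el 0ℤ 0ℤ 0ℤ 0ℤ

_•_ : ℤ → El → El
k • el x0 x1 x2 x3 = el (k * x0) (k * x1) (k * x2) (k * x3)

-- Multiplication in Q_F (Birch–Merriman / Nakagawa table).  Writing
-- a = a4, b = a3, c = a2, d = a1, e = a0, the table is
--   ζ1ζ1 = - b ζ1 + a ζ2
--   ζ1ζ2 = - c ζ1 + a ζ3
--   ζ1ζ3 = - a e - d ζ1
--   ζ2ζ2 = - a e - d ζ1 - c ζ2 + b ζ3
--   ζ2ζ3 = - b e - e ζ1 - d ζ2
--   ζ3ζ3 = - c e - e ζ2 - d ζ3
-- (obtained from ζ1 = aθ, ζ2 = aθ²+bθ, ζ3 = aθ³+bθ²+cθ, F(θ,1)=0),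
-- extended bilinearly; 1 is the identity.
mulQ : BQF → El → El → El
mulQ (bqf a b c d e) (el u0 u1 u2 u3) (el v0 v1 v2 v3) =
  el (u0 * v0 + (u1 * v3 + u3 * v1) * (- (a * e)) + u2 * v2 * (- (a * e))
        + (u2 * v3 + u3 * v2) * (- (b * e)) + u3 * v3 * (- (c * e)))
     (u0 * v1 + u1 * v0 + u1 * v1 * (- b) + (u1 * v2 + u2 * v1) * (- c)
        + (u1 * v3 + u3 * v1) * (- d) + u2 * v2 * (- d) + (u2 * v3 + u3 * v2) * (- e))
     (u0 * v2 + u2 * v0 + u1 * v1 * a + u2 * v2 * (- c)
        + (u2 * v3 + u3 * v2) * (- d) + u3 * v3 * (- e))
     (u0 * v3 + u3 * v0 + (u1 * v2 + u2 * v1) * a + u2 * v2 * b + u3 * v3 * (- d))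

-- A proper overring R' of Q_F with Q_F ⊊ R' ⊆ p^{-k} Q_F, encoded by the
-- lattice M = p^k R' ⊆ Q_F (given as a predicate on Q_F = ℤ⁴):
--  * M is an additive subgroup of Q_F,
--  * p^k Q_F ⊆ M               (i.e. Q_F ⊆ R'; in particular 1 ∈ R'),
--  * M M ⊆ p^k M               (i.e. R' R' ⊆ R'),
--  * M ⊄ p^k Q_F               (i.e. R' ≠ Q_F).
record Overring (F : BQF) (p k : ℕ) : Set₁ where
  field
    M       : El → Set
    M-zero  : M zeroEl
    M-add   : ∀ x y → M x → M y → M (x ⊕ y)
    M-neg   : ∀ x → M x → M (⊖ x)
    M-ext   : ∀ x → M ((+ (p ^ k)) • x)
    M-mul   : ∀ x y → M x → M y →
                Σ El (λ z → M z × mulQ F x y ≡ (+ (p ^ k)) • z)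
    M-proper : Σ El (λ x → M x × ¬ Σ El (λ y → x ≡ (+ (p ^ k)) • y))

-- Q_F is non-maximal at p iff Z_p ⊗ Q_F is properly contained in a quartic
-- ring over Z_p, iff Q_F has a proper overring of p-power index.
NonMaximalAt : BQF → ℕ → Set₁
NonMaximalAt F p = Σ ℕ (λ k → Overring F p k)

MaximalAt : BQF → ℕ → Set₁
MaximalAt F p = ¬ NonMaximalAt F p

diagF : ℤ → ℤ → ℤ → BQF
diagF A B C = bqf A 0ℤ B 0ℤ C

{-# OPTIONS --safe #-}

-- Non-maximality is witnessed by rings Q_F[g/p], where g ∈ Q_F is nonzero mod p and g/p is a root of a
-- monic quadratic polynomial over Q_F.
--
-- Conversely, for an overring R′ ≠ Q_F the ideal I = p R′ ∩ Q_F strictly contains p Q_F, its elements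
-- are nilpotent mod p, and x, y ∈ I with x y = p w implies w ∈ I. Q_F contains the quadratic ring
-- S = ℤ[ζ₂] of discriminant D = B² − 4AC, and Q_F = S ⊕ (ℤζ₁ + ℤζ₃) is the eigenspace decomposition of
-- the involution σ (θ ↦ −θ). For odd p we may replace R′ by R′ σ(R′), so that I is σ-stable and hence
-- decomposes accordingly; then I ∩ S ⊆ p S because p² ∤ D, and the products of an element of
-- I ∩ (ℤζ₁ + ℤζ₃) with ζ₁, ζ₃ and itself lie in I ∩ S, which makes its coordinates divisible by p.
-- For p = 2 these properties of I depend only on A, B, C mod 4 and on elements mod 2; for each
-- admissible residue class, squaring a nonzero element of I repeatedly, and halving the square when
-- possible, leads to an element of I that is not nilpotent mod 2.

module Submission where

open import Defs
open import Data.Nat using (ℕ) renaming (_*_ to _*ℕ_)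
open import Relation.Binary.PropositionalEquality using (_≢_)
open import Data.Nat.Primality using (Prime)
open import Data.Integer using (ℤ; +_; _+_; _-_; _*_)
open import Data.Integer.Divisibility using (_∣_)
open import Data.Product using (_×_)
open import Data.Sum using (_⊎_)
open import Function.Bundles using (_⇔_)
open import Relation.Nullary using (¬_)

open import Algebra.Bundles using (CommutativeRing; CommutativeSemiring)
open import Algebra.Structures using (IsCommutativeRing)
open import Data.Empty using (⊥; ⊥-elim)
open import Data.Fin using (Fin; toℕ; fromℕ<)
open import Data.Fin.Properties using (all?; toℕ-fromℕ<)
open import Data.Integer using (NonZero; -_; 0ℤ; 1ℤ)
import Data.Integer as Z
open import Data.Integer.Divisibility.Signed
  using (divides; _∣?_; ∣ᵤ⇒∣; ∣⇒∣ᵤ; ∣-refl; ∣-trans; ∣m⇒∣-m; ∣m∣n⇒∣m+n; ∣m∣n⇒∣m-n; ∣m+n∣m⇒∣n; ∣m+n∣n⇒∣m;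
         ∣m⇒∣m*n; ∣n⇒∣m*n; *-monoˡ-∣; *-monoʳ-∣; *-cancelʳ-∣)
  renaming (_∣_ to _∣ˢ_)
open import Data.Integer.DivMod using (_%ℕ_; _/ℕ_; n%ℕd<d; a≡a%ℕn+[a/ℕn]*n)
import Data.Integer.Properties as ℤ
open import Data.Integer.Solver using (module +-*-Solver)
open import Data.Nat using (zero; suc; _^_) renaming (_+_ to _+ℕ_)
import Data.Nat as ℕ
import Data.Nat.Divisibility as ℕ
open import Data.Nat.Primality using (prime[2]; ¬prime[1]; euclidsLemma; prime⇒nonZero; prime⇒irreducible)
import Data.Nat.Properties as ℕ
open import Data.Product using (Σ; ∃; ∃₂; _,_; proj₁; proj₂)
open import Data.Sum using (inj₁; inj₂; [_,_]′)
import Data.Sum as Sum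
open import Data.Vec using (Vec; []; _∷_; allFin; map)
open import Data.Vec.N-ary using (N-ary; _$ⁿ_)
open import Function using (id)
open import Function.Bundles using (mk⇔)
open import Level using (0ℓ)
open import Relation.Binary.PropositionalEquality
  using (_≡_; refl; sym; trans; cong; cong₂; subst; isEquivalence; module ≡-Reasoning)
open import Relation.Nullary using (Dec; yes; no; contradiction)
open import Relation.Nullary.Decidable using (map′; _×-dec_; _⊎-dec_; _→-dec_; ¬?; from-no; toWitness)

open El
open +-*-Solver
  using (Polynomial; con; var; _:=_; _:+_; _:*_; :-_; _:-_; ⟦_⟧; ⟦_⟧↓; prove)
  renaming (solve to ℤ-solve)

-- Coordinates and the ring structure of Q_F.

el-cong : ∀ {a b c d a′ b′ c′ d′} → a ≡ a′ → b ≡ b′ → c ≡ c′ → d ≡ d′ →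
          el a b c d ≡ el a′ b′ c′ d′
el-cong refl refl refl refl = refl

-- Elements of Q_F whose coordinates are polynomial expressions: evaluation turns
-- the operations below into those of Defs definitionally, so the integer ring
-- solver decides identities in Q_F coordinatewise.
record Coords (n : ℕ) : Set where
  constructor coords
  field
    c0 c1 c2 c3 : Polynomial n

module _ {n : ℕ} where
  infixl 6 _⊞_
  infixr 7 _⊡_

  _⊞_ : Coords n → Coords n → Coords n
  coords x0 x1 x2 x3 ⊞ coords y0 y1 y2 y3 = coords (x0 :+ y0) (x1 :+ y1) (x2 :+ y2) (x3 :+ y3)

  _⊡_ : Polynomial n → Coords n → Coords n
  k ⊡ coords x0 x1 x2 x3 = coords (k :* x0) (k :* x1) (k :* x2) (k :* x3)

  :0 :1 : Polynomial n
  :0 = con 0ℤ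
  :1 = con 1ℤ

  mulᶜ : Polynomial n → Polynomial n → Polynomial n → Coords n → Coords n → Coords n
  mulᶜ a c e (coords u0 u1 u2 u3) (coords v0 v1 v2 v3) = coords
    (u0 :* v0 :+ (u1 :* v3 :+ u3 :* v1) :* (:- (a :* e)) :+ u2 :* v2 :* (:- (a :* e))
       :+ (u2 :* v3 :+ u3 :* v2) :* (:- (:0 :* e)) :+ u3 :* v3 :* (:- (c :* e)))
    (u0 :* v1 :+ u1 :* v0 :+ u1 :* v1 :* (:- :0) :+ (u1 :* v2 :+ u2 :* v1) :* (:- c)
       :+ (u1 :* v3 :+ u3 :* v1) :* (:- :0) :+ u2 :* v2 :* (:- :0) :+ (u2 :* v3 :+ u3 :* v2) :* (:- e))
    (u0 :* v2 :+ u2 :* v0 :+ u1 :* v1 :* a :+ u2 :* v2 :* (:- c)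
       :+ (u2 :* v3 :+ u3 :* v2) :* (:- :0) :+ u3 :* v3 :* (:- e))
    (u0 :* v3 :+ u3 :* v0 :+ (u1 :* v2 :+ u2 :* v1) :* a :+ u2 :* v2 :* :0 :+ u3 :* v3 :* (:- :0))

  ⟦_⟧ᶜ ⟦_⟧ᶜ↓ : Coords n → Vec ℤ n → El
  ⟦ coords a b c d ⟧ᶜ  ρ = el (⟦ a ⟧ ρ) (⟦ b ⟧ ρ) (⟦ c ⟧ ρ) (⟦ d ⟧ ρ)
  ⟦ coords a b c d ⟧ᶜ↓ ρ = el (⟦ a ⟧↓ ρ) (⟦ b ⟧↓ ρ) (⟦ c ⟧↓ ρ) (⟦ d ⟧↓ ρ)

infix 4 _⊜_
_⊜_ : ∀ {n} → Coords n → Coords n → Coords n × Coords n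
_⊜_ = _,_

close : ∀ n {A : Set} → N-ary n (Polynomial n) A → A
close n f = f $ⁿ map var (allFin n)

-- The hypothesis compares the normal forms of all four coordinates at once, so a valid identity is
-- discharged by `refl`.
solveᶜ : ∀ n (f : N-ary n (Polynomial n) (Coords n × Coords n)) (ρ : Vec ℤ n) →
         let (l , r) = close n f in ⟦ l ⟧ᶜ↓ ρ ≡ ⟦ r ⟧ᶜ↓ ρ → ⟦ l ⟧ᶜ ρ ≡ ⟦ r ⟧ᶜ ρ
solveᶜ n f ρ eq with close n f
... | coords a b c d , coords a′ b′ c′ d′ = el-cong
  (prove ρ a a′ (cong e0 eq)) (prove ρ b b′ (cong e1 eq))
  (prove ρ c c′ (cong e2 eq)) (prove ρ d d′ (cong e3 eq))

⊕-assoc : ∀ x y z → (x ⊕ y) ⊕ z ≡ x ⊕ (y ⊕ z)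
⊕-assoc (el a b c d) (el e f g h) (el i j k l) =
  el-cong (ℤ.+-assoc a e i) (ℤ.+-assoc b f j) (ℤ.+-assoc c g k) (ℤ.+-assoc d h l)

⊕-comm : ∀ x y → x ⊕ y ≡ y ⊕ x
⊕-comm (el a b c d) (el e f g h) =
  el-cong (ℤ.+-comm a e) (ℤ.+-comm b f) (ℤ.+-comm c g) (ℤ.+-comm d h)

⊕-identityˡ : ∀ x → zeroEl ⊕ x ≡ x
⊕-identityˡ x = el-cong (ℤ.+-identityˡ _) (ℤ.+-identityˡ _) (ℤ.+-identityˡ _) (ℤ.+-identityˡ _)

⊕-inverseˡ : ∀ x → (⊖ x) ⊕ x ≡ zeroEl
⊕-inverseˡ (el a b c d) =
  el-cong (ℤ.+-inverseˡ a) (ℤ.+-inverseˡ b) (ℤ.+-inverseˡ c) (ℤ.+-inverseˡ d)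

•-identity : ∀ x → 1ℤ • x ≡ x
•-identity x = el-cong (ℤ.*-identityˡ _) (ℤ.*-identityˡ _) (ℤ.*-identityˡ _) (ℤ.*-identityˡ _)

•-assoc : ∀ j k x → j • (k • x) ≡ (j * k) • x
•-assoc j k x = sym (el-cong (ℤ.*-assoc j k _) (ℤ.*-assoc j k _) (ℤ.*-assoc j k _) (ℤ.*-assoc j k _))

•-distrib-⊕ : ∀ k x y → k • (x ⊕ y) ≡ (k • x) ⊕ (k • y)
•-distrib-⊕ k x y =
  el-cong (ℤ.*-distribˡ-+ k _ _) (ℤ.*-distribˡ-+ k _ _) (ℤ.*-distribˡ-+ k _ _) (ℤ.*-distribˡ-+ k _ _)

•-cancel : ∀ k .{{_ : NonZero k}} {x y} → k • x ≡ k • y → x ≡ y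
•-cancel k eq = el-cong
  (ℤ.*-cancelˡ-≡ k _ _ (cong e0 eq)) (ℤ.*-cancelˡ-≡ k _ _ (cong e1 eq))
  (ℤ.*-cancelˡ-≡ k _ _ (cong e2 eq)) (ℤ.*-cancelˡ-≡ k _ _ (cong e3 eq))

scalar : ℤ → El
scalar k = el k 0ℤ 0ℤ 0ℤ

module QuarticRing (A B C : ℤ) where

  infixl 7 _·_

  opaque
    -- Opaque, so that products do not unfold into coordinate polynomials; `·≡mulQ` leads back to
    -- the multiplication table.
    _·_ : El → El → El
    _·_ = mulQ (diagF A B C)

    ·≡mulQ : ∀ x y → x · y ≡ mulQ (diagF A B C) x y
    ·≡mulQ x y = refl

    ·-assoc : ∀ x y z → (x · y) · z ≡ x · (y · z)
    ·-assoc (el a b c d) (el e f g h) (el i j k l) = solveᶜ 15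
      (λ A B C a b c d e f g h i j k l →
         let _⊛_ = mulᶜ A B C ; x = coords a b c d ; y = coords e f g h ; z = coords i j k l in
         (x ⊛ y) ⊛ z ⊜ x ⊛ (y ⊛ z))
      (A ∷ B ∷ C ∷ a ∷ b ∷ c ∷ d ∷ e ∷ f ∷ g ∷ h ∷ i ∷ j ∷ k ∷ l ∷ []) refl

    ·-comm : ∀ x y → x · y ≡ y · x
    ·-comm (el a b c d) (el e f g h) = solveᶜ 11
      (λ A B C a b c d e f g h →
         let _⊛_ = mulᶜ A B C ; x = coords a b c d ; y = coords e f g h in
         x ⊛ y ⊜ y ⊛ x)
      (A ∷ B ∷ C ∷ a ∷ b ∷ c ∷ d ∷ e ∷ f ∷ g ∷ h ∷ []) refl

    ·-distribˡ-⊕ : ∀ x y z → x · (y ⊕ z) ≡ (x · y) ⊕ (x · z)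
    ·-distribˡ-⊕ (el a b c d) (el e f g h) (el i j k l) = solveᶜ 15
      (λ A B C a b c d e f g h i j k l →
         let _⊛_ = mulᶜ A B C ; x = coords a b c d ; y = coords e f g h ; z = coords i j k l in
         x ⊛ (y ⊞ z) ⊜ (x ⊛ y) ⊞ (x ⊛ z))
      (A ∷ B ∷ C ∷ a ∷ b ∷ c ∷ d ∷ e ∷ f ∷ g ∷ h ∷ i ∷ j ∷ k ∷ l ∷ []) refl

    -- Identifies scaling by k with multiplication by the image of k in Q_F, so that the laws
    -- relating `•` and `·` follow from associativity and commutativity.
    scalar-· : ∀ k x → scalar k · x ≡ k • x
    scalar-· k (el a b c d) = solveᶜ 8
      (λ A B C k a b c d → mulᶜ A B C (coords k :0 :0 :0) (coords a b c d) ⊜ k ⊡ coords a b c d)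
      (A ∷ B ∷ C ∷ k ∷ a ∷ b ∷ c ∷ d ∷ []) refl

  •-·ˡ : ∀ k x y → (k • x) · y ≡ k • (x · y)
  •-·ˡ k x y = begin
    (k • x) · y          ≡⟨ cong (_· y) (scalar-· k x) ⟨
    (scalar k · x) · y   ≡⟨ ·-assoc (scalar k) x y ⟩
    scalar k · (x · y)   ≡⟨ scalar-· k (x · y) ⟩
    k • (x · y)          ∎
    where open ≡-Reasoning

  •-·ʳ : ∀ k x y → x · (k • y) ≡ k • (x · y)
  •-·ʳ k x y = trans (·-comm x (k • y)) (trans (•-·ˡ k y x) (cong (k •_) (·-comm y x)))

  ·-identityˡ : ∀ x → scalar 1ℤ · x ≡ x
  ·-identityˡ x = trans (scalar-· 1ℤ x) (•-identity x)

  ring : CommutativeRing 0ℓ 0ℓ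
  ring = record
    { Carrier = El ; _≈_ = _≡_ ; _+_ = _⊕_ ; _*_ = _·_ ; -_ = ⊖_ ; 0# = zeroEl ; 1# = scalar 1ℤ
    ; isCommutativeRing = record
      { isRing = record
        { +-isAbelianGroup = record
          { isGroup = record
            { isMonoid = record
              { isSemigroup = record
                { isMagma = record { isEquivalence = isEquivalence ; ∙-cong = cong₂ _⊕_ }
                ; assoc = ⊕-assoc }
              ; identity = comm∧idˡ⇒id ⊕-comm ⊕-identityˡ }
            ; inverse = comm∧invˡ⇒inv ⊕-comm ⊕-inverseˡ
            ; ⁻¹-cong = cong ⊖_ }
          ; comm = ⊕-comm }
        ; *-cong = cong₂ _·_
        ; *-assoc = ·-assoc
        ; *-identity = comm∧idˡ⇒id ·-comm ·-identityˡ
        ; distrib = comm∧distrˡ⇒distr (cong₂ _⊕_) ·-comm ·-distribˡ-⊕ }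
      ; *-comm = ·-comm } }
    where open import Algebra.Consequences.Propositional

-- Adjoining g/p to a ring.

module _ {c ℓ} (R : CommutativeSemiring c ℓ) where
  open CommutativeSemiring R using (_≈_; setoid; +-cong; *-cong)
    renaming (_+_ to _⊹_; _*_ to _∙_; refl to ≈-refl)
  open import Relation.Binary.Reasoning.Setoid setoid
  open import Algebra.Solver.Ring.NaturalCoefficients.Default R
    using (solve) renaming (_:=_ to _=ᵖ_; _:+_ to _+ᵖ_; _:*_ to _*ᵖ_)

  -- Closure of the lattice p R + g R under (x, y) ↦ x y / p. After expansion only the term in g² is
  -- not visibly p times an element of the lattice, and the quadratic relation for g supplies the
  -- missing factor.
  adjoin-∙ : ∀ p g h l q r s t → g ∙ g ≈ p ∙ (g ∙ h) ⊹ p ∙ p ∙ l →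
    (p ∙ q ⊹ g ∙ r) ∙ (p ∙ s ⊹ g ∙ t) ≈
    p ∙ (p ∙ (q ∙ s ⊹ l ∙ (r ∙ t)) ⊹ g ∙ (q ∙ t ⊹ r ∙ s ⊹ h ∙ (r ∙ t)))
  adjoin-∙ p g h l q r s t g²≈ = begin
    (p ∙ q ⊹ g ∙ r) ∙ (p ∙ s ⊹ g ∙ t)
      ≈⟨ solve 6 (λ p g q r s t →
           (p *ᵖ q +ᵖ g *ᵖ r) *ᵖ (p *ᵖ s +ᵖ g *ᵖ t) =ᵖ
           p *ᵖ (p *ᵖ (q *ᵖ s) +ᵖ g *ᵖ (q *ᵖ t +ᵖ r *ᵖ s)) +ᵖ g *ᵖ g *ᵖ (r *ᵖ t))
         ≈-refl p g q r s t ⟩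
    p ∙ (p ∙ (q ∙ s) ⊹ g ∙ (q ∙ t ⊹ r ∙ s)) ⊹ g ∙ g ∙ (r ∙ t)
      ≈⟨ +-cong ≈-refl (*-cong g²≈ ≈-refl) ⟩
    p ∙ (p ∙ (q ∙ s) ⊹ g ∙ (q ∙ t ⊹ r ∙ s)) ⊹ (p ∙ (g ∙ h) ⊹ p ∙ p ∙ l) ∙ (r ∙ t)
      ≈⟨ solve 8 (λ p g h l q r s t →
           p *ᵖ (p *ᵖ (q *ᵖ s) +ᵖ g *ᵖ (q *ᵖ t +ᵖ r *ᵖ s)) +ᵖ (p *ᵖ (g *ᵖ h) +ᵖ p *ᵖ p *ᵖ l) *ᵖ (r *ᵖ t) =ᵖ
           p *ᵖ (p *ᵖ (q *ᵖ s +ᵖ l *ᵖ (r *ᵖ t)) +ᵖ g *ᵖ (q *ᵖ t +ᵖ r *ᵖ s +ᵖ h *ᵖ (r *ᵖ t))))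
         ≈-refl p g h l q r s t ⟩
    p ∙ (p ∙ (q ∙ s ⊹ l ∙ (r ∙ t)) ⊹ g ∙ (q ∙ t ⊹ r ∙ s ⊹ h ∙ (r ∙ t))) ∎

infix 4 _∣ᵉ_
_∣ᵉ_ : ℤ → El → Set
k ∣ᵉ x = Σ El λ y → x ≡ k • y

module _ {F : BQF} (p : ℕ) (M : El → Set) where

  -- Overrings inside p⁻¹ Q_F, that is k = 1. For a variable p the power `p ^ 1` does not reduce to
  -- `p`, hence the transports.
  overring₁ : M zeroEl → (∀ x y → M x → M y → M (x ⊕ y)) → (∀ x → M x → M (⊖ x)) →
    (∀ x → M ((+ p) • x)) →
    (∀ x y → M x → M y → Σ El λ z → M z × mulQ F x y ≡ (+ p) • z) →
    (Σ El λ x → M x × ¬ (+ p ∣ᵉ x)) → NonMaximalAt F p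
  overring₁ M-zero M-add M-neg M-ext M-mul M-proper = 1 , record
    { M = M ; M-zero = M-zero ; M-add = M-add ; M-neg = M-neg
    ; M-ext = subst (λ n → ∀ x → M ((+ n) • x)) p≡p¹ M-ext
    ; M-mul = subst (λ n → ∀ x y → M x → M y → Σ El λ z → M z × mulQ F x y ≡ (+ n) • z) p≡p¹ M-mul
    ; M-proper = subst (λ n → Σ El λ x → M x × ¬ (+ n ∣ᵉ x)) p≡p¹ M-proper }
    where
    p≡p¹ : p ≡ p ^ 1
    p≡p¹ = sym (ℕ.^-identityʳ p)

module NonMaximal (A B C : ℤ) (p : ℕ) where
  open QuarticRing A B C
  open CommutativeRing ring using (commutativeSemiring; distribˡ; zeroʳ; +-identityʳ; *-identityʳ)
  open import Algebra.Properties.CommutativeSemigroup (CommutativeRing.+-commutativeSemigroup ring)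
    using () renaming (interchange to ⊕-interchange)
  open import Algebra.Properties.Ring (CommutativeRing.ring ring) using (-‿distribʳ-*; -‿+-comm)

  private
    π : El
    π = scalar (+ p)

  -- p⁻¹ (p Q_F + g Q_F) = Q_F[g/p], since g/p is a root of X² − h X − l.
  adjoin : ∀ g h l → mulQ (diagF A B C) g g ≡ ((+ p) • mulQ (diagF A B C) g h) ⊕ ((+ p * + p) • l) →
           ¬ (+ p ∣ᵉ g) → NonMaximalAt (diagF A B C) p
  adjoin g h l g²≡ p∤g = overring₁ p M
    (zeroEl , zeroEl , sym (trans (cong₂ _⊕_ (zeroʳ π) (zeroʳ g)) (⊕-identityˡ zeroEl)))
    (λ { _ _ (q , r , refl) (s , t , refl) → q ⊕ s , r ⊕ t ,
         trans (⊕-interchange (π · q) (g · r) (π · s) (g · t))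
           (sym (cong₂ _⊕_ (distribˡ π q s) (distribˡ g r t))) })
    (λ { _ (q , r , refl) → ⊖ q , ⊖ r ,
         trans (sym (-‿+-comm (π · q) (g · r))) (cong₂ _⊕_ (-‿distribʳ-* π q) (-‿distribʳ-* g r)) })
    (λ x → x , zeroEl ,
         sym (trans (cong₂ _⊕_ (scalar-· (+ p) x) (zeroʳ g)) (+-identityʳ _)))
    (λ { _ _ (q , r , refl) (s , t , refl) → _ ,
         ((q · s) ⊕ (l · (r · t)) , ((q · t) ⊕ (r · s)) ⊕ (h · (r · t)) , refl) ,
         trans (sym (·≡mulQ _ _))
           (trans (adjoin-∙ commutativeSemiring π g h l q r s t g²≡′) (scalar-· (+ p) _)) })
    (g , (zeroEl , scalar 1ℤ ,
          sym (trans (cong₂ _⊕_ (zeroʳ π) (*-identityʳ g)) (⊕-identityˡ g))) , p∤g)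
    where
    M : El → Set
    M x = ∃₂ λ q r → x ≡ (π · q) ⊕ (g · r)

    g²≡′ : g · g ≡ (π · (g · h)) ⊕ ((π · π) · l)
    g²≡′ = trans (trans (·≡mulQ g g) g²≡) (sym (cong₂ _⊕_
      (trans (scalar-· (+ p) (g · h)) (cong ((+ p) •_) (·≡mulQ g h))) (begin
      (π · π) · l           ≡⟨ ·-assoc π π l ⟩
      π · (π · l)           ≡⟨ scalar-· (+ p) (π · l) ⟩
      (+ p) • (π · l)       ≡⟨ cong ((+ p) •_) (scalar-· (+ p) l) ⟩
      (+ p) • ((+ p) • l)   ≡⟨ •-assoc (+ p) (+ p) l ⟩
      (+ p * + p) • l       ∎)))
      where open ≡-Reasoning

-- Non-maximality when one of the conditions fails.

2∤1 : ¬ (+ 2 ∣ˢ 1ℤ)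
2∤1 = from-no (+ 2 ∣? 1ℤ)

∣ᵉ⇒∣ : ∀ {k x} → k ∣ᵉ x → k ∣ˢ e0 x × k ∣ˢ e1 x × k ∣ˢ e2 x × k ∣ˢ e3 x
∣ᵉ⇒∣ {k} (el a b c d , refl) =
  divides a (ℤ.*-comm k a) , divides b (ℤ.*-comm k b) , divides c (ℤ.*-comm k c) , divides d (ℤ.*-comm k d)

∣⇒∣ᵉ : ∀ {k a b c d} → k ∣ˢ a → k ∣ˢ b → k ∣ˢ c → k ∣ˢ d → k ∣ᵉ el a b c d
∣⇒∣ᵉ {k} (divides a refl) (divides b refl) (divides c refl) (divides d refl) =
  el a b c d , el-cong (ℤ.*-comm a k) (ℤ.*-comm b k) (ℤ.*-comm c k) (ℤ.*-comm d k)

module _ (A B C : ℤ) (p : ℕ) (p∤1 : ¬ (+ p ∣ˢ 1ℤ)) where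

  -- Since ζ₁² = A ζ₂, the square of ζ₁/p lies in Q_F.
  p²∣A⇒nonMaximal : + p * + p ∣ˢ A → NonMaximalAt (diagF A B C) p
  p²∣A⇒nonMaximal (divides a refl) =
    NonMaximal.adjoin A B C p (el 0ℤ 1ℤ 0ℤ 0ℤ) zeroEl (el 0ℤ 0ℤ a 0ℤ)
      (solveᶜ 4 (λ p a B C →
          let _⊛_ = mulᶜ (a :* (p :* p)) B C ; g = coords :0 :1 :0 :0 in
          g ⊛ g ⊜ (p ⊡ (g ⊛ coords :0 :0 :0 :0)) ⊞ ((p :* p) ⊡ coords :0 :0 a :0))
        (+ p ∷ a ∷ B ∷ C ∷ []) refl)
      (λ p∣g → p∤1 (proj₁ (proj₂ (∣ᵉ⇒∣ p∣g))))

  -- Since ζ₃² = - B C - C ζ₂, the square of ζ₃/p lies in Q_F.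
  p²∣C⇒nonMaximal : + p * + p ∣ˢ C → NonMaximalAt (diagF A B C) p
  p²∣C⇒nonMaximal (divides c refl) =
    NonMaximal.adjoin A B C p (el 0ℤ 0ℤ 0ℤ 1ℤ) zeroEl (el (- (c * B)) 0ℤ (- c) 0ℤ)
      (solveᶜ 4 (λ p A B c →
          let _⊛_ = mulᶜ A B (c :* (p :* p)) ; g = coords :0 :0 :0 :1 in
          g ⊛ g ⊜ (p ⊡ (g ⊛ coords :0 :0 :0 :0)) ⊞ ((p :* p) ⊡ coords (:- (c :* B)) :0 (:- c) :0))
        (+ p ∷ A ∷ B ∷ c ∷ []) refl)
      (λ p∣g → p∤1 (proj₂ (proj₂ (proj₂ (∣ᵉ⇒∣ p∣g)))))

  -- The element g = B + 2 ζ₂ satisfies g² = B² - 4AC; it is nonzero mod p because its ζ₂-coordinate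
  -- is 2.
  p²∣D⇒nonMaximal : ¬ (+ p ∣ˢ + 2) → + p * + p ∣ˢ B * B - + 4 * A * C →
                    NonMaximalAt (diagF A B C) p
  p²∣D⇒nonMaximal p∤2 (divides d D≡) =
    NonMaximal.adjoin A B C p (el B 0ℤ (+ 2) 0ℤ) zeroEl (scalar d)
      (trans
        (solveᶜ 4 (λ A B C p →
            let _⊛_ = mulᶜ A B C ; g = coords B :0 (con (+ 2)) :0 in
            g ⊛ g ⊜ (p ⊡ (g ⊛ coords :0 :0 :0 :0)) ⊞ coords (B :* B :- con (+ 4) :* A :* C) :0 :0 :0)
          (A ∷ B ∷ C ∷ + p ∷ []) refl)
        (cong (((+ p) • mulQ (diagF A B C) (el B 0ℤ (+ 2) 0ℤ) zeroEl) ⊕_)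
          (el-cong (trans D≡ (ℤ.*-comm d (+ p * + p)))
            (sym (ℤ.*-zeroʳ (+ p * + p))) (sym (ℤ.*-zeroʳ (+ p * + p))) (sym (ℤ.*-zeroʳ (+ p * + p))))))
      (λ p∣g → p∤2 (proj₁ (proj₂ (proj₂ (∣ᵉ⇒∣ p∣g)))))

  -- Q_F embeds in the quartic ring of F / p by ζᵢ ↦ p ζᵢ.
  content⇒nonMaximal : + p ∣ˢ A → + p ∣ˢ B → + p ∣ˢ C → NonMaximalAt (diagF A B C) p
  content⇒nonMaximal (divides a refl) (divides b refl) (divides c refl) = overring₁ p M
    (divides 0ℤ refl)
    (λ { _ _ (divides m refl) (divides n refl) → divides (m + n) (sym (ℤ.*-distribʳ-+ (+ p) m n)) })
    (λ { _ (divides m refl) → divides (- m) (ℤ.neg-distribˡ-* m (+ p)) })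
    (λ { (el x _ _ _) → divides x (ℤ.*-comm (+ p) x) })
    (λ { (el _ x y z) (el _ u v w) (divides m refl) (divides n refl) →
       el _ _ _ _ ,
       divides (m * n + (x * w + z * u) * (- (a * c)) + y * v * (- (a * c)) + z * w * (- (b * c))) refl ,
       solveᶜ 12 (λ a b c p m n x y z u v w →
          let _⊛_ = mulᶜ (a :* p) (b :* p) (c :* p) in
          coords (m :* p) x y z ⊛ coords (n :* p) u v w ⊜
          p ⊡ coords
            ((m :* n :+ (x :* w :+ z :* u) :* (:- (a :* c)) :+ y :* v :* (:- (a :* c))
                :+ z :* w :* (:- (b :* c))) :* p)
            (m :* u :+ n :* x :+ (x :* v :+ y :* u) :* (:- b) :+ (y :* w :+ z :* v) :* (:- c))
            (m :* v :+ n :* y :+ x :* u :* a :+ y :* v :* (:- b) :+ z :* w :* (:- c))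
            (m :* w :+ n :* z :+ (x :* v :+ y :* u) :* a))
         (a ∷ b ∷ c ∷ + p ∷ m ∷ n ∷ x ∷ y ∷ z ∷ u ∷ v ∷ w ∷ []) refl })
    (el 0ℤ 1ℤ 0ℤ 0ℤ , divides 0ℤ refl , λ p∣ζ → p∤1 (proj₁ (proj₂ (∣ᵉ⇒∣ p∣ζ))))
    where
    -- This is p R′ for the ring R′ with basis 1, ζ₁/p, ζ₂/p, ζ₃/p.
    M : El → Set
    M x = + p ∣ˢ e0 x

module _ (A B C : ℤ) where

  -- g is the value at θ of the polynomial (F(x,1) − F(1,1)) / (x − 1), so g (θ − 1) = − F(1,1).
  4∣A+B+C⇒nonMaximal : + 4 ∣ˢ A + B + C → NonMaximalAt (diagF A B C) 2
  4∣A+B+C⇒nonMaximal (divides e A+B+C≡) =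
    NonMaximal.adjoin A B C 2 g (scalar (+ 2 * A + B)) ((- e) • q)
      (trans
        -- Let G be the polynomial with g = G(θ). Then G(1) is the derivative 4A + 2B of F(x,1) at
        -- 1, and G(x) = G(1) + (x - 1) H(x) with H(θ) = `q`. Multiplying by g and using g (θ - 1) =
        -- - F(1,1) gives g² = 2 (2A + B) g - F(1,1) q.
        (solveᶜ 3 (λ A B C →
            let _⊛_ = mulᶜ A B C ; g = coords (A :+ B) :1 :1 :1 in
            g ⊛ g ⊜ (con (+ 2) ⊡ (g ⊛ coords (con (+ 2) :* A :+ B) :0 :0 :0))
                      ⊞ ((:- (A :+ B :+ C)) ⊡ coords (con (+ 3) :* A :+ B) (con (+ 2)) :1 :0))
          (A ∷ B ∷ C ∷ []) refl)
        (cong (((+ 2) • mulQ (diagF A B C) g (scalar (+ 2 * A + B))) ⊕_)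
          (trans (cong (λ k → (- k) • q) A+B+C≡)
            (trans (cong (_• q) (trans (ℤ.neg-distribˡ-* e (+ 4)) (ℤ.*-comm (- e) (+ 4))))
              (sym (•-assoc (+ 4) (- e) q))))))
      (λ 2∣g → 2∤1 (proj₁ (proj₂ (∣ᵉ⇒∣ 2∣g))))
    where
    g q : El
    g = el (A + B) 1ℤ 1ℤ 1ℤ
    q = el (+ 3 * A + B) (+ 2) 1ℤ 0ℤ

  -- F lies in the square of the ideal (2, x² + xy + y²), and g = A (θ² + θ + 1).
  A≡B≡C⇒nonMaximal : + 4 ∣ˢ A - B → + 4 ∣ˢ A - C → NonMaximalAt (diagF A B C) 2
  A≡B≡C⇒nonMaximal (divides u A-B≡) (divides v A-C≡) =
    NonMaximal.adjoin A B C 2 (el A 1ℤ 1ℤ 0ℤ) (el 0ℤ 1ℤ 0ℤ 0ℤ) (el (A * v) 0ℤ u 0ℤ)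
      (trans
        -- From (x² + x + 1)² = 2x (x² + x + 1) + (x⁴ + x² + 1), multiplied by A² at x = θ;
        -- subtracting F(θ,1) = 0 turns A (θ⁴ + θ² + 1) into (A - B) θ² + (A - C).
        (solveᶜ 3 (λ A B C →
            let _⊛_ = mulᶜ A B C ; g = coords A :1 :1 :0 in
            g ⊛ g ⊜ (con (+ 2) ⊡ (g ⊛ coords :0 :1 :0 :0))
                      ⊞ coords (A :* (A :- C)) :0 (A :- B) :0)
          (A ∷ B ∷ C ∷ []) refl)
        (cong (((+ 2) • mulQ (diagF A B C) (el A 1ℤ 1ℤ 0ℤ) (el 0ℤ 1ℤ 0ℤ 0ℤ)) ⊕_)
          (el-cong
            (trans (cong (A *_) A-C≡) (trans (sym (ℤ.*-assoc A v (+ 4))) (ℤ.*-comm (A * v) (+ 4))))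
            refl (trans A-B≡ (ℤ.*-comm u (+ 4))) refl)))
      (λ 2∣g → 2∤1 (proj₁ (proj₂ (∣ᵉ⇒∣ 2∣g))))

-- Overrings of a commutative ring with a cancellable element π.

module Fractional {A : Set} {_⊹_ _∙_ : A → A → A} {neg : A → A} {𝟘 𝟙 : A}
  (isCommutativeRing : IsCommutativeRing _≡_ _⊹_ _∙_ neg 𝟘 𝟙)
  (π : A) (π-cancel : ∀ x y → π ∙ x ≡ π ∙ y → x ≡ y) where

  private
    commutativeRing : CommutativeRing _ _
    commutativeRing = record { isCommutativeRing = isCommutativeRing }
    commutativeSemiring : CommutativeSemiring _ _
    commutativeSemiring = CommutativeRing.commutativeSemiring commutativeRing

  open IsCommutativeRing isCommutativeRing
    using (*-assoc; *-identityˡ; +-assoc; +-identityʳ; -‿inverseʳ; distribˡ)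
  open import Algebra.Properties.Ring (CommutativeRing.ring commutativeRing) using (-‿distribʳ-*)
  open import Algebra.Solver.Ring.NaturalCoefficients.Default commutativeSemiring
    using (solve) renaming (con to conᵖ; _:=_ to _=ᵖ_; _:+_ to _+ᵖ_; _:*_ to _*ᵖ_)
  open ≡-Reasoning

  infixr 8 _↑_
  _↑_ : A → ℕ → A
  x ↑ zero  = 𝟙
  x ↑ suc n = x ∙ (x ↑ n)

  ↑-+ : ∀ x m n → x ↑ (m +ℕ n) ≡ (x ↑ m) ∙ (x ↑ n)
  ↑-+ x zero    n = sym (*-identityˡ (x ↑ n))
  ↑-+ x (suc m) n = trans (cong (x ∙_) (↑-+ x m n)) (sym (*-assoc x (x ↑ m) (x ↑ n)))

  π↑-cancel : ∀ n x y → (π ↑ n) ∙ x ≡ (π ↑ n) ∙ y → x ≡ y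
  π↑-cancel zero    x y eq = trans (sym (*-identityˡ x)) (trans eq (*-identityˡ y))
  π↑-cancel (suc n) x y eq = π↑-cancel n x y (π-cancel _ _
    (trans (sym (*-assoc π (π ↑ n) x)) (trans eq (*-assoc π (π ↑ n) y))))

  -- M is πᵏ⁺¹ R′ for an overring R′ of A.
  module Overlattice (k : ℕ) (M : A → Set)
    (M-add : ∀ x y → M x → M y → M (x ⊹ y))
    (M-ext : ∀ x → M ((π ↑ suc k) ∙ x))
    (M-mul : ∀ x y → M x → M y → Σ A λ z → M z × x ∙ y ≡ (π ↑ suc k) ∙ z) where

    private
      P P⁺ : A
      P  = π ↑ k
      P⁺ = π ↑ suc k

    -- As A ⊆ R′, the lattice is an A-module: q is represented in M by πᵏ⁺¹ q, and the extra power
    -- of π cancels.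
    M-ideal : ∀ q x → M x → M (q ∙ x)
    M-ideal q x x∈M =
      let z , z∈M , eq = M-mul (P⁺ ∙ q) x (M-ext q) x∈M in
      subst M (π↑-cancel (suc k) z (q ∙ x) (trans (sym eq) (*-assoc P⁺ q x))) z∈M

    -- I = π R′ ∩ A
    I : A → Set
    I x = M (P ∙ x)

    I-add : ∀ x y → I x → I y → I (x ⊹ y)
    I-add x y x∈I y∈I = subst M (sym (distribˡ P x y)) (M-add _ _ x∈I y∈I)

    I-mul : ∀ q x → I x → I (q ∙ x)
    I-mul q x x∈I = subst M
      (solve 3 (λ q P x → q *ᵖ (P *ᵖ x) =ᵖ P *ᵖ (q *ᵖ x)) refl q P x)
      (M-ideal q (P ∙ x) x∈I)

    I-ext : ∀ x → I (π ∙ x)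
    I-ext x = subst M
      (solve 3 (λ π P x → (π *ᵖ P) *ᵖ x =ᵖ P *ᵖ (π *ᵖ x)) refl π P x)
      (M-ext x)

    -- Both x/π and y/π lie in R′, hence so does their product w/π.
    I-div : ∀ x y w → I x → I y → x ∙ y ≡ π ∙ w → I w
    I-div x y w x∈I y∈I xy≡πw =
      let z , z∈M , eq = M-mul (P ∙ x) (P ∙ y) x∈I y∈I in
      subst M (π↑-cancel (suc k) z (P ∙ w) (begin
        P⁺ ∙ z              ≡⟨ eq ⟨
        (P ∙ x) ∙ (P ∙ y)   ≡⟨ solve 3 (λ P x y → (P *ᵖ x) *ᵖ (P *ᵖ y) =ᵖ P *ᵖ P *ᵖ (x *ᵖ y)) refl P x y ⟩
        (P ∙ P) ∙ (x ∙ y)   ≡⟨ cong ((P ∙ P) ∙_) xy≡πw ⟩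
        (P ∙ P) ∙ (π ∙ w)   ≡⟨ solve 3 (λ P π w → (P *ᵖ P) *ᵖ (π *ᵖ w) =ᵖ (π *ᵖ P) *ᵖ (P *ᵖ w)) refl P π w ⟩
        P⁺ ∙ (P ∙ w)        ∎)) z∈M

    -- The witness z is πᵏ⁺¹ (x/π)ⁿ, which lies in M because (x/π)ⁿ lies in R′; the equation is this
    -- with denominators cleared.
    I-power : ∀ x → I x → ∀ n → ∃ λ z → M z × (π ↑ n) ∙ z ≡ P⁺ ∙ (x ↑ n)
    I-power x x∈I zero    = P⁺ ∙ 𝟙 , M-ext 𝟙 , *-identityˡ (P⁺ ∙ 𝟙)
    I-power x x∈I (suc n) =
      let z , z∈M , eq  = I-power x x∈I n
          w , w∈M , eq′ = M-mul (P ∙ x) z x∈I z∈M in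
      w , w∈M , π↑-cancel (suc k) _ _ (begin
        P⁺ ∙ ((π ↑ suc n) ∙ w)
          ≡⟨ solve 4 (λ Q π T w → Q *ᵖ ((π *ᵖ T) *ᵖ w) =ᵖ (π *ᵖ T) *ᵖ (Q *ᵖ w)) refl P⁺ π (π ↑ n) w ⟩
        (π ↑ suc n) ∙ (P⁺ ∙ w)
          ≡⟨ cong ((π ↑ suc n) ∙_) eq′ ⟨
        (π ↑ suc n) ∙ ((P ∙ x) ∙ z)
          ≡⟨ solve 5 (λ π T P x z → (π *ᵖ T) *ᵖ ((P *ᵖ x) *ᵖ z) =ᵖ (π *ᵖ P) *ᵖ (x *ᵖ (T *ᵖ z)))
               refl π (π ↑ n) P x z ⟩
        P⁺ ∙ (x ∙ ((π ↑ n) ∙ z))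
          ≡⟨ cong (λ u → P⁺ ∙ (x ∙ u)) eq ⟩
        P⁺ ∙ (x ∙ (P⁺ ∙ (x ↑ n)))
          ≡⟨ cong (P⁺ ∙_) (solve 3 (λ Q x T → x *ᵖ (Q *ᵖ T) =ᵖ Q *ᵖ (x *ᵖ T)) refl P⁺ x (x ↑ n)) ⟩
        P⁺ ∙ (P⁺ ∙ (x ↑ suc n)) ∎)

    -- All powers of x/π lie in R′, hence have denominator at most πᵏ⁺¹.
    I-nilpotent : ∀ x → I x → ∃ λ w → x ↑ suc (suc k) ≡ π ∙ w
    I-nilpotent x x∈I =
      -- The exponent k + 2 exceeds the largest denominator exponent k + 1 by one, so a single
      -- factor π is left over.
      let w , _ , eq = I-power x x∈I (suc (suc k)) in
      w , sym (π↑-cancel (suc k) (π ∙ w) (x ↑ suc (suc k))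
        (trans (solve 3 (λ Q π w → Q *ᵖ (π *ᵖ w) =ᵖ (π *ᵖ Q) *ᵖ w) refl P⁺ π w) eq))

    private
      -- Modulo π, each further multiplication by x acts on x as multiplication by T.
      ↑-suc-≡ : ∀ x T z → x ∙ x ≡ (T ∙ x) ⊹ (π ∙ z) →
        ∀ n → ∃ λ w → x ↑ suc n ≡ ((T ↑ n) ∙ x) ⊹ (π ∙ w)
      ↑-suc-≡ x T z eq zero    = 𝟘 ,
        solve 2 (λ x π → x *ᵖ conᵖ 1 =ᵖ conᵖ 1 *ᵖ x +ᵖ π *ᵖ conᵖ 0) refl x π
      ↑-suc-≡ x T z eq (suc n) =
        let w , eq′ = ↑-suc-≡ x T z eq n in
        ((T ↑ n) ∙ z) ⊹ (x ∙ w) , (begin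
          x ∙ (x ↑ suc n)
            ≡⟨ cong (x ∙_) eq′ ⟩
          x ∙ (((T ↑ n) ∙ x) ⊹ (π ∙ w))
            ≡⟨ solve 4 (λ x S π w → x *ᵖ (S *ᵖ x +ᵖ π *ᵖ w) =ᵖ S *ᵖ (x *ᵖ x) +ᵖ π *ᵖ (x *ᵖ w)) refl x (T ↑ n) π w ⟩
          ((T ↑ n) ∙ (x ∙ x)) ⊹ (π ∙ (x ∙ w))
            ≡⟨ cong (λ u → ((T ↑ n) ∙ u) ⊹ (π ∙ (x ∙ w))) eq ⟩
          ((T ↑ n) ∙ ((T ∙ x) ⊹ (π ∙ z))) ⊹ (π ∙ (x ∙ w))
            ≡⟨ solve 6 (λ x S T π z w → S *ᵖ (T *ᵖ x +ᵖ π *ᵖ z) +ᵖ π *ᵖ (x *ᵖ w)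
                 =ᵖ (T *ᵖ S) *ᵖ x +ᵖ π *ᵖ (S *ᵖ z +ᵖ x *ᵖ w)) refl x (T ↑ n) T π z w ⟩
          ((T ↑ suc n) ∙ x) ⊹ (π ∙ (((T ↑ n) ∙ z) ⊹ (x ∙ w))) ∎)

    -- Two evaluations of xᵏ⁺² modulo π: it vanishes by nilpotence, and it equals Tᵏ⁺¹ x by the
    -- quadratic relation.
    I-quasi-idempotent : ∀ x T z → I x → x ∙ x ≡ (T ∙ x) ⊹ (π ∙ z) →
      ∃ λ w → (T ↑ suc k) ∙ x ≡ π ∙ w
    I-quasi-idempotent x T z x∈I eq =
      let u , eq₁ = I-nilpotent x x∈I
          v , eq₂ = ↑-suc-≡ x T z eq (suc k)
      in u ⊹ neg v , (begin
        (T ↑ suc k) ∙ x                                     ≡⟨ +-identityʳ _ ⟨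
        ((T ↑ suc k) ∙ x) ⊹ 𝟘                               ≡⟨ cong (((T ↑ suc k) ∙ x) ⊹_) (-‿inverseʳ (π ∙ v)) ⟨
        ((T ↑ suc k) ∙ x) ⊹ ((π ∙ v) ⊹ neg (π ∙ v))         ≡⟨ +-assoc _ _ _ ⟨
        (((T ↑ suc k) ∙ x) ⊹ (π ∙ v)) ⊹ neg (π ∙ v)         ≡⟨ cong₂ _⊹_ (trans (sym eq₂) eq₁) (-‿distribʳ-* π v) ⟩
        (π ∙ u) ⊹ (π ∙ neg v)                               ≡⟨ distribˡ π u (neg v) ⟨
        π ∙ (u ⊹ neg v)                                     ∎)

    -- Factors π are split off x one at a time. If x = πʲ y with i + j = k, then πⁱ x = πᵏ y lies in
    -- M, so y lies in I and is itself divisible by π.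
    I⊆πA⇒M⊆P⁺A : (∀ x → I x → ∃ λ y → x ≡ π ∙ y) → ∀ x → M x → ∃ λ y → x ≡ P⁺ ∙ y
    I⊆πA⇒M⊆P⁺A I⊆πA x x∈M = descend (suc k) 0 refl
      where
      descend : ∀ j i → i +ℕ j ≡ suc k → ∃ λ y → x ≡ (π ↑ j) ∙ y
      descend zero    i eq = x , sym (*-identityˡ x)
      descend (suc j) i eq =
        let y , x≡πʲy = descend j (suc i) (trans (sym (ℕ.+-suc i j)) eq)
            z , y≡πz  = I⊆πA y (subst M (begin
              (π ↑ i) ∙ x                  ≡⟨ cong ((π ↑ i) ∙_) x≡πʲy ⟩
              (π ↑ i) ∙ ((π ↑ j) ∙ y)      ≡⟨ *-assoc (π ↑ i) (π ↑ j) y ⟨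
              ((π ↑ i) ∙ (π ↑ j)) ∙ y      ≡⟨ cong (_∙ y) (↑-+ π i j) ⟨
              (π ↑ (i +ℕ j)) ∙ y           ≡⟨ cong (λ n → (π ↑ n) ∙ y) (ℕ.suc-injective (trans (sym (ℕ.+-suc i j)) eq)) ⟩
              P ∙ y                        ∎) (M-ideal (π ↑ i) x x∈M))
        in z , (begin
          x                          ≡⟨ x≡πʲy ⟩
          (π ↑ j) ∙ y                ≡⟨ cong ((π ↑ j) ∙_) y≡πz ⟩
          (π ↑ j) ∙ (π ∙ z)          ≡⟨ solve 3 (λ T π z → T *ᵖ (π *ᵖ z) =ᵖ (π *ᵖ T) *ᵖ z) refl (π ↑ j) π z ⟩
          (π ↑ suc j) ∙ z            ∎)

-- The ideal I = p R′ ∩ Q_F at a prime p.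

euclid : ∀ {p} → Prime p → ∀ m n → + p ∣ˢ m * n → + p ∣ˢ m ⊎ + p ∣ˢ n
euclid {p} pr m n p∣mn = Sum.map ∣ᵤ⇒∣ ∣ᵤ⇒∣
  (euclidsLemma Z.∣ m ∣ Z.∣ n ∣ pr (subst (p ℕ.∣_) (ℤ.abs-* m n) (∣⇒∣ᵤ p∣mn)))

euclid-• : ∀ {p} → Prime p → ∀ T x → + p ∣ᵉ T • x → + p ∣ˢ T ⊎ + p ∣ᵉ x
euclid-• {p} pr T (el a b c d) p∣Tx with + p ∣? T | ∣ᵉ⇒∣ p∣Tx
... | yes p∣T | _ = inj₁ p∣T
... | no  p∤T | p∣Ta , p∣Tb , p∣Tc , p∣Td = inj₂ (∣⇒∣ᵉ (cancel p∣Ta) (cancel p∣Tb) (cancel p∣Tc) (cancel p∣Td))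
  where
  cancel : ∀ {m} → + p ∣ˢ T * m → + p ∣ˢ m
  cancel {m} p∣Tm = [ (λ p∣T → contradiction p∣T p∤T) , id ]′ (euclid pr T m p∣Tm)

-- Properties of I stated without the lattice M and the exponent k, so that they can be transferred
-- to congruent coefficients. `I-nil` is nilpotence mod p in the form applied later: x² ≡ T x mod p
-- forces T ≡ 0 or x ≡ 0.
record LocalIdeal (A B C : ℤ) (p : ℕ) (I : El → Set) : Set where
  open QuarticRing A B C
  field
    I-add : ∀ x y → I x → I y → I (x ⊕ y)
    I-mul : ∀ q x → I x → I (q · x)
    I-ext : ∀ x → I ((+ p) • x)
    I-div : ∀ x y w → I x → I y → x · y ≡ (+ p) • w → I w
    I-nil : ∀ x T z → I x → x · x ≡ (T • x) ⊕ ((+ p) • z) → + p ∣ˢ T ⊎ + p ∣ᵉ x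

module FromOverring {A B C : ℤ} {p : ℕ} (pr : Prime p) (k : ℕ)
                    (R : Overring (diagF A B C) p (suc k)) where
  open QuarticRing A B C
  open Overring R
  open ≡-Reasoning

  private
    instance
      p≢0 : ℕ.NonZero p
      p≢0 = prime⇒nonZero pr

    π : El
    π = scalar (+ p)

    π-cancel : ∀ x y → π · x ≡ π · y → x ≡ y
    π-cancel x y eq = •-cancel (+ p) (trans (sym (scalar-· (+ p) x)) (trans eq (scalar-· (+ p) y)))

  open Fractional (CommutativeRing.isCommutativeRing ring) π π-cancel

  ↑-· : ∀ n x → (π ↑ n) · x ≡ (+ (p ^ n)) • x
  ↑-· zero    x = scalar-· 1ℤ x
  ↑-· (suc n) x = begin
    (π · (π ↑ n)) · x           ≡⟨ ·-assoc π (π ↑ n) x ⟩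
    π · ((π ↑ n) · x)           ≡⟨ cong (π ·_) (↑-· n x) ⟩
    π · ((+ (p ^ n)) • x)       ≡⟨ scalar-· (+ p) ((+ (p ^ n)) • x) ⟩
    (+ p) • ((+ (p ^ n)) • x)   ≡⟨ •-assoc (+ p) (+ (p ^ n)) x ⟩
    (+ p * + (p ^ n)) • x       ≡⟨ cong (_• x) (ℤ.pos-* p (p ^ n)) ⟨
    (+ (p ^ suc n)) • x         ∎

  private
    M-ext′ : ∀ x → M ((π ↑ suc k) · x)
    M-ext′ x = subst M (sym (↑-· (suc k) x)) (M-ext x)

    M-mul′ : ∀ x y → M x → M y → Σ El λ z → M z × x · y ≡ (π ↑ suc k) · z
    M-mul′ x y x∈M y∈M =
      let z , z∈M , eq = M-mul x y x∈M y∈M in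
      z , z∈M , trans (·≡mulQ x y) (trans eq (sym (↑-· (suc k) z)))

  open Overlattice k M M-add M-ext′ M-mul′ public

  private
    scalar-↑-· : ∀ T n x → + p ∣ᵉ (scalar T ↑ n) · x → + p ∣ˢ T ⊎ + p ∣ᵉ x
    scalar-↑-· T zero    x p∣x   = inj₂ (subst (+ p ∣ᵉ_) (·-identityˡ x) p∣x)
    scalar-↑-· T (suc n) x p∣TTx = [ inj₁ , scalar-↑-· T n x ]′
      (euclid-• pr T _ (subst (+ p ∣ᵉ_)
        (trans (·-assoc (scalar T) (scalar T ↑ n) x) (scalar-· T _)) p∣TTx))

  localIdeal : LocalIdeal A B C p I
  localIdeal = record
    { I-add = I-add
    ; I-mul = I-mul
    ; I-ext = λ x → subst I (scalar-· (+ p) x) (I-ext x)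
    ; I-div = λ x y w x∈I y∈I xy≡pw → I-div x y w x∈I y∈I (trans xy≡pw (sym (scalar-· (+ p) w)))
    ; I-nil = λ x T z x∈I x²≡ →
        let w , eq = I-quasi-idempotent x (scalar T) z x∈I
                       (trans x²≡ (sym (cong₂ _⊕_ (scalar-· T x) (scalar-· (+ p) z))))
        in scalar-↑-· T (suc k) x (w , trans eq (scalar-· (+ p) w)) }

  -- The descent would put all of M inside pᵏ⁺¹ Q_F, against `M-proper`.
  I⊆pQ⇒⊥ : (∀ x → I x → + p ∣ᵉ x) → ⊥
  I⊆pQ⇒⊥ I⊆pQ =
    let x , x∈M , x∉P⁺Q = M-proper
        y , eq = I⊆πA⇒M⊆P⁺A
          (λ x x∈I → let y , x≡py = I⊆pQ x x∈I in y , trans x≡py (sym (scalar-· (+ p) y))) x x∈M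
    in x∉P⁺Q (y , trans eq (↑-· (suc k) y))

  I-stable : (f : El → El) → (∀ n x → f (n • x) ≡ n • f x) → (∀ x → M x → M (f x)) →
             ∀ x → I x → I (f x)
  I-stable f f-• M-stable x x∈I = subst M (begin
    f ((π ↑ k) · x)         ≡⟨ cong f (↑-· k x) ⟩
    f ((+ (p ^ k)) • x)     ≡⟨ f-• (+ (p ^ k)) x ⟩
    (+ (p ^ k)) • f x       ≡⟨ ↑-· k (f x) ⟨
    (π ↑ k) · f x           ∎) (M-stable _ x∈I)

-- The involution σ and the compositum of an overring with its conjugate.

σ : El → El
σ (el a b c d) = el a (- b) c (- d)

σ-⊕ : ∀ x y → σ (x ⊕ y) ≡ σ x ⊕ σ y
σ-⊕ (el a b c d) (el e f g h) = el-cong refl (ℤ.neg-distrib-+ b f) refl (ℤ.neg-distrib-+ d h)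

σ-• : ∀ k x → σ (k • x) ≡ k • σ x
σ-• k (el a b c d) = el-cong refl (ℤ.neg-distribʳ-* k b) refl (ℤ.neg-distribʳ-* k d)

σ-involutive : ∀ x → σ (σ x) ≡ x
σ-involutive (el a b c d) = el-cong refl (ℤ.neg-involutive b) refl (ℤ.neg-involutive d)

module _ (A B C : ℤ) where
  open QuarticRing A B C

  -- The coefficients a3 and a1 vanish, so the multiplication table respects the grading in which
  -- ζ₁, ζ₃ are odd and 1, ζ₂ are even.
  σ-· : ∀ x y → σ (x · y) ≡ σ x · σ y
  σ-· x@(el a b c d) y@(el e f g h) =
    trans (cong σ (·≡mulQ x y)) (trans
      (solveᶜ 11 (λ A B C a b c d e f g h →
         let _⊛_ = mulᶜ A B C
             σᶜ : Coords 11 → Coords 11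
             σᶜ = λ { (coords a b c d) → coords a (:- b) c (:- d) }
             x = coords a b c d ; y = coords e f g h in
         σᶜ (x ⊛ y) ⊜ σᶜ x ⊛ σᶜ y)
        (A ∷ B ∷ C ∷ a ∷ b ∷ c ∷ d ∷ e ∷ f ∷ g ∷ h ∷ []) refl)
      (sym (·≡mulQ (σ x) (σ y))))

module Symmetrise {A B C : ℤ} {p k : ℕ} .{{_ : ℕ.NonZero p}} (R : Overring (diagF A B C) p k) where
  open QuarticRing A B C
  open CommutativeRing ring using (distribʳ; zeroˡ; *-commutativeSemigroup)
  open import Algebra.Properties.Ring (CommutativeRing.ring ring) using (-‿distribˡ-*; -‿+-comm)
  open import Algebra.Properties.CommutativeSemigroup *-commutativeSemigroup
    using () renaming (interchange to ·-interchange)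
  open Overring R
  open ≡-Reasoning

  -- The lattice of the ring R′ σ(R′) generated by R′ and its conjugate.
  data Compositum : El → Set where
    gen  : ∀ x y {z} → M x → M y → z ≡ x · σ y → Compositum z
    plus : ∀ x y {z} → Compositum x → Compositum y → z ≡ x ⊕ y → Compositum z

  private
    instance
      pᵏ≢0 : ℕ.NonZero (p ^ k)
      pᵏ≢0 = ℕ.m^n≢0 p k

    P : ℤ
    P = + (p ^ k)

    P² : + (p ^ (k +ℕ k)) ≡ P * P
    P² = trans (cong +_ (ℕ.^-distribˡ-+-* p k k)) (ℤ.pos-* (p ^ k) (p ^ k))

    𝟙 : El
    𝟙 = scalar 1ℤ

    -- The element `P • 𝟙` represents 1 ∈ R′ in M; taking it as second factor embeds R′ into the
    -- compositum.
    ·σP : ∀ x → x · σ (P • 𝟙) ≡ P • x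
    ·σP x = begin
      x · σ (P • 𝟙)   ≡⟨ cong (x ·_) (σ-• P 𝟙) ⟩
      x · (P • 𝟙)     ≡⟨ •-·ʳ P x 𝟙 ⟩
      P • (x · 𝟙)     ≡⟨ cong (P •_) (trans (·-comm x 𝟙) (·-identityˡ x)) ⟩
      P • x           ∎

  compositum-neg : ∀ {x} → Compositum x → Compositum (⊖ x)
  compositum-neg (gen x y x∈M y∈M refl)  = gen (⊖ x) y (M-neg x x∈M) y∈M (-‿distribˡ-* x (σ y))
  compositum-neg (plus x y x∈ y∈ refl) =
    plus (⊖ x) (⊖ y) (compositum-neg x∈) (compositum-neg y∈) (sym (-‿+-comm x y))

  -- As σ² = 1, conjugation exchanges the two factors of a generator.
  compositum-σ : ∀ x → Compositum x → Compositum (σ x)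
  compositum-σ _ (gen x y x∈M y∈M refl) = gen y x y∈M x∈M (begin
    σ (x · σ y)      ≡⟨ σ-· A B C x (σ y) ⟩
    σ x · σ (σ y)    ≡⟨ cong (σ x ·_) (σ-involutive y) ⟩
    σ x · y          ≡⟨ ·-comm (σ x) y ⟩
    y · σ x          ∎)
  compositum-σ _ (plus x y x∈ y∈ refl) =
    plus (σ x) (σ y) (compositum-σ x x∈) (compositum-σ y y∈) (σ-⊕ x y)

  -- On generators (x σy)(z σw) = (x z) σ(y w), and each of the two products in M contributes a
  -- factor pᵏ; sums follow by distributivity.
  compositum-mul : ∀ {x y} → Compositum x → Compositum y →
                   Σ El λ z → Compositum z × x · y ≡ (P * P) • z
  compositum-mul {y = w} (plus x y x∈ y∈ refl) w∈ =
    let u , u∈ , xw≡ = compositum-mul x∈ w∈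
        v , v∈ , yw≡ = compositum-mul y∈ w∈
    in u ⊕ v , plus u v u∈ v∈ refl , (begin
      (x ⊕ y) · w                          ≡⟨ distribʳ w x y ⟩
      (x · w) ⊕ (y · w)                    ≡⟨ cong₂ _⊕_ xw≡ yw≡ ⟩
      ((P * P) • u) ⊕ ((P * P) • v)        ≡⟨ •-distrib-⊕ (P * P) u v ⟨
      (P * P) • (u ⊕ v)                    ∎)
  compositum-mul {w} w∈@(gen _ _ _ _ _) (plus x y x∈ y∈ refl) =
    let u , u∈ , wx≡ = compositum-mul w∈ x∈
        v , v∈ , wy≡ = compositum-mul w∈ y∈
    in u ⊕ v , plus u v u∈ v∈ refl , (begin
      w · (x ⊕ y)                          ≡⟨ ·-distribˡ-⊕ w x y ⟩
      (w · x) ⊕ (w · y)                    ≡⟨ cong₂ _⊕_ wx≡ wy≡ ⟩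
      ((P * P) • u) ⊕ ((P * P) • v)        ≡⟨ •-distrib-⊕ (P * P) u v ⟨
      (P * P) • (u ⊕ v)                    ∎)
  compositum-mul (gen x y x∈M y∈M refl) (gen z w z∈M w∈M refl) =
    let u , u∈M , xz≡ = M-mul x z x∈M z∈M
        v , v∈M , yw≡ = M-mul y w y∈M w∈M
    in u · σ v , gen u v u∈M v∈M refl , (begin
      (x · σ y) · (z · σ w)       ≡⟨ ·-interchange x (σ y) z (σ w) ⟩
      (x · z) · (σ y · σ w)       ≡⟨ cong ((x · z) ·_) (σ-· A B C y w) ⟨
      (x · z) · σ (y · w)         ≡⟨ cong₂ (λ s t → s · σ t) (trans (·≡mulQ x z) xz≡) (trans (·≡mulQ y w) yw≡) ⟩
      (P • u) · σ (P • v)         ≡⟨ cong ((P • u) ·_) (σ-• P v) ⟩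
      (P • u) · (P • σ v)         ≡⟨ •-·ˡ P u (P • σ v) ⟩
      P • (u · (P • σ v))         ≡⟨ cong (P •_) (•-·ʳ P u (σ v)) ⟩
      P • (P • (u · σ v))         ≡⟨ •-assoc P P (u · σ v) ⟩
      (P * P) • (u · σ v)         ∎)

  -- Denominators multiply, so the exponent doubles. The compositum contains R′, hence still differs
  -- from Q_F.
  overring : Overring (diagF A B C) p (k +ℕ k)
  overring = record
    { M = Compositum
    ; M-zero = gen zeroEl zeroEl M-zero M-zero (sym (zeroˡ (σ zeroEl)))
    ; M-add = λ x y x∈ y∈ → plus x y x∈ y∈ refl
    ; M-neg = λ x x∈ → compositum-neg x∈
    ; M-ext = λ x → gen (P • x) (P • 𝟙) (M-ext x) (M-ext 𝟙)
        (trans (cong (_• x) P²) (trans (sym (•-assoc P P x)) (sym (·σP (P • x)))))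
    ; M-mul = λ x y x∈ y∈ →
        let z , z∈ , xy≡ = compositum-mul x∈ y∈ in
        z , z∈ , trans (sym (·≡mulQ x y)) (trans xy≡ (cong (_• z) (sym P²)))
    ; M-proper =
        let x , x∈M , x∉PQ = M-proper in
        P • x , gen x (P • 𝟙) x∈M (M-ext 𝟙) (sym (·σP x)) ,
        λ { (y , Px≡) → x∉PQ (y , •-cancel P
              (trans Px≡ (trans (cong (_• y) P²) (sym (•-assoc P P y))))) } }

-- Odd primes: I ⊆ p Q_F.

*-mono-∣ : ∀ {i j m n} → i ∣ˢ m → j ∣ˢ n → i * j ∣ˢ m * n
*-mono-∣ {i} {j} {m} {n} i∣m j∣n = ∣-trans (*-monoˡ-∣ j i∣m) (*-monoʳ-∣ m j∣n)

euclid-∤ : ∀ {p} → Prime p → ∀ {m n} → ¬ (+ p ∣ˢ m) → ¬ (+ p ∣ˢ n) → ¬ (+ p ∣ˢ m * n)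
euclid-∤ pr {m} {n} p∤m p∤n p∣mn = [ p∤m , p∤n ]′ (euclid pr m n p∣mn)

euclid-∣ : ∀ {p} → Prime p → ∀ {m n} → ¬ (+ p ∣ˢ m) → + p ∣ˢ m * n → + p ∣ˢ n
euclid-∣ pr {m} {n} p∤m p∣mn = [ (λ p∣m → contradiction p∣m p∤m) , id ]′ (euclid pr m n p∣mn)

module _ {p : ℕ} (pr : Prime p) where

  private
    instance
      p≢0 : ℕ.NonZero p
      p≢0 = prime⇒nonZero pr

  -- Here n has p-adic valuation exactly 1 and m is a unit at p, so m n has valuation 1.
  prime-sq-∤ : ∀ {m n} → ¬ (+ p ∣ˢ m) → + p ∣ˢ n → ¬ (+ p * + p ∣ˢ n) → ¬ (+ p * + p ∣ˢ m * n)
  prime-sq-∤ {m} p∤m (divides n refl) p²∤n p²∣mn =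
    euclid-∤ pr p∤m (λ p∣n → p²∤n (*-monoˡ-∣ (+ p) p∣n))
      (*-cancelʳ-∣ (+ p) (subst (+ p * + p ∣ˢ_) (sym (ℤ.*-assoc m n (+ p))) p²∣mn))

  module _ {A B C : ℤ} (p²∤A : ¬ (+ p * + p ∣ˢ A)) (p²∤C : ¬ (+ p * + p ∣ˢ C))
           (content : ¬ (+ p ∣ˢ A × + p ∣ˢ B × + p ∣ˢ C)) where

    -- The hypotheses are what membership of t = b ζ₁ + d ζ₃ in I yields through t ζ₁, t ζ₃ and t².
    -- If p ∤ b then A has valuation 1, and if p ∤ d then C has. When only one of b, d is prime to
    -- p, b² A - d² C has valuation 1. When both are, p ∤ B by the content condition, so 2 b A + B d
    -- is prime to p and the last product has valuation 1.
    coefficients-divisible : ∀ b d → + p ∣ˢ b * A → + p ∣ˢ d * C →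
      + p * + p ∣ˢ b * b * A - d * d * C → + p * + p ∣ˢ d * C * (+ 2 * b * A + B * d) →
      + p ∣ˢ b × + p ∣ˢ d
    coefficients-divisible b d p∣bA p∣dC p²∣₁ p²∣₂ with + p ∣? b | + p ∣? d
    ... | yes p∣b | yes p∣d = p∣b , p∣d
    ... | yes p∣b | no  p∤d = contradiction
      (subst (+ p * + p ∣ˢ_) (ℤ.neg-involutive _)
        (∣m⇒∣-m (∣m+n∣m⇒∣n p²∣₁ (∣m⇒∣m*n A (*-mono-∣ p∣b p∣b)))))
      (prime-sq-∤ (euclid-∤ pr p∤d p∤d) (euclid-∣ pr p∤d p∣dC) p²∤C)
    ... | no  p∤b | yes p∣d = contradiction
      (∣m+n∣n⇒∣m p²∣₁ (∣m⇒∣-m (∣m⇒∣m*n C (*-mono-∣ p∣d p∣d))))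
      (prime-sq-∤ (euclid-∤ pr p∤b p∤b) (euclid-∣ pr p∤b p∣bA) p²∤A)
    ... | no  p∤b | no  p∤d = contradiction
      (subst (+ p * + p ∣ˢ_) (d*C*e≡d*e*C (+ 2 * b * A + B * d)) p²∣₂)
      (prime-sq-∤ (euclid-∤ pr p∤d p∤e) p∣C p²∤C)
      where
      d*C*e≡d*e*C : ∀ e → d * C * e ≡ d * e * C
      d*C*e≡d*e*C e = trans (ℤ.*-assoc d C e) (trans (cong (d *_) (ℤ.*-comm C e)) (sym (ℤ.*-assoc d e C)))
      p∣A : + p ∣ˢ A
      p∣A = euclid-∣ pr p∤b p∣bA
      p∣C : + p ∣ˢ C
      p∣C = euclid-∣ pr p∤d p∣dC
      p∤e : ¬ (+ p ∣ˢ + 2 * b * A + B * d)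
      p∤e p∣e = euclid-∤ pr (λ p∣B → content (p∣A , p∣B , p∣C)) p∤d
        (∣m+n∣m⇒∣n p∣e (∣n⇒∣m*n (+ 2 * b) p∣A))

∣-m⇒∣m : ∀ {k m} → k ∣ˢ - m → k ∣ˢ m
∣-m⇒∣m {k} {m} k∣-m = subst (k ∣ˢ_) (ℤ.neg-involutive m) (∣m⇒∣-m k∣-m)

module LocalIdealProperties {A B C : ℤ} {p : ℕ} {I : El → Set} (L : LocalIdeal A B C p I) where
  open QuarticRing A B C
  open LocalIdeal L

  I-mulQ : ∀ q x y → mulQ (diagF A B C) q x ≡ y → I x → I y
  I-mulQ q x y qx≡y x∈I = subst I (trans (·≡mulQ q x) qx≡y) (I-mul q x x∈I)

  I-pQ : ∀ {x} → + p ∣ᵉ x → I x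
  I-pQ (y , refl) = I-ext y

  I-divQ : ∀ x y w → I x → I y → mulQ (diagF A B C) x y ≡ (+ p) • w → I w
  I-divQ x y w x∈I y∈I eq = I-div x y w x∈I y∈I (trans (·≡mulQ x y) eq)

  I-nilQ : ∀ x T z → I x → mulQ (diagF A B C) x x ≡ (T • x) ⊕ ((+ p) • z) → + p ∣ˢ T ⊎ + p ∣ᵉ x
  I-nilQ x T z x∈I eq = I-nil x T z x∈I (trans (·≡mulQ x x) eq)

  -- An integer n satisfies x² = T x with T = n, so `I-nil` applies to it.
  I∩ℤ : ∀ n → I (scalar n) → + p ∣ˢ n
  I∩ℤ n n∈I = [ id , (λ p∣n → proj₁ (∣ᵉ⇒∣ p∣n)) ]′ (I-nilQ (scalar n) n zeroEl n∈I
    (solveᶜ 5 (λ A B C p n → let x = coords n :0 :0 :0 in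
        mulᶜ A B C x x ⊜ (n ⊡ x) ⊞ (p ⊡ coords :0 :0 :0 :0))
      (A ∷ B ∷ C ∷ + p ∷ n ∷ []) refl))

module OddPrime {A B C : ℤ} {p : ℕ} (pr : Prime p) (p∤2 : ¬ (+ p ∣ˢ + 2))
                {I : El → Set} (L : LocalIdeal A B C p I)
                (p²∤D : ¬ (+ p * + p ∣ˢ B * B - + 4 * A * C)) where
  open QuarticRing A B C
  open LocalIdeal L
  open LocalIdealProperties L

  halve : ∀ {n} → + p ∣ˢ n + n → + p ∣ˢ n
  halve {n} p∣2n = euclid-∣ pr p∤2 (subst (+ p ∣ˢ_) (sym 2n≡n+n) p∣2n)
    where
    2n≡n+n : + 2 * n ≡ n + n
    2n≡n+n = trans (ℤ.*-distribʳ-+ n 1ℤ 1ℤ) (cong₂ _+_ (ℤ.*-identityˡ n) (ℤ.*-identityˡ n))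

  -- For s = a + b ζ₂ with trace T and norm N over ℤ: N = s s̄ lies in I, so s² ≡ T s mod p;
  -- and 2 s − T = b δ, where δ = B + 2 ζ₂ has δ² = B² − 4 A C.
  I∩S : ∀ a b → I (el a 0ℤ b 0ℤ) → + p ∣ˢ a × + p ∣ˢ b
  I∩S a b s∈I = [ p∣T⇒ , (λ p∣s → let p∣a , _ , p∣b , _ = ∣ᵉ⇒∣ p∣s in p∣a , p∣b) ]′ p∣T⊎p∣s
    where
    T N D : ℤ
    T = + 2 * a - B * b
    N = a * a - a * b * B + b * b * (A * C)
    D = B * B - + 4 * A * C

    p∣N : + p ∣ˢ N
    p∣N = I∩ℤ N (I-mulQ (el (a - B * b) 0ℤ (- b) 0ℤ) (el a 0ℤ b 0ℤ) (scalar N)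
      (solveᶜ 5 (λ A B C a b →
          mulᶜ A B C (coords (a :- B :* b) :0 (:- b) :0) (coords a :0 b :0) ⊜
          coords (a :* a :- a :* b :* B :+ b :* b :* (A :* C)) :0 :0 :0)
        (A ∷ B ∷ C ∷ a ∷ b ∷ []) refl) s∈I)

    s²≡ : mulQ (diagF A B C) (el a 0ℤ b 0ℤ) (el a 0ℤ b 0ℤ) ≡ (T • el a 0ℤ b 0ℤ) ⊕ scalar (- N)
    s²≡ = solveᶜ 5 (λ A B C a b → let s = coords a :0 b :0 in
          mulᶜ A B C s s ⊜
          ((con (+ 2) :* a :- B :* b) ⊡ s) ⊞ coords (:- (a :* a :- a :* b :* B :+ b :* b :* (A :* C))) :0 :0 :0)
        (A ∷ B ∷ C ∷ a ∷ b ∷ []) refl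

    p∣T⊎p∣s : + p ∣ˢ T ⊎ + p ∣ᵉ el a 0ℤ b 0ℤ
    p∣T⊎p∣s =
      let z , -N≡pz = ∣⇒∣ᵉ (∣m⇒∣-m p∣N) p∣0 p∣0 p∣0 in
      I-nilQ (el a 0ℤ b 0ℤ) T z s∈I (trans s²≡ (cong ((T • el a 0ℤ b 0ℤ) ⊕_) -N≡pz))
      where
      p∣0 : + p ∣ˢ 0ℤ
      p∣0 = divides 0ℤ refl

    bδ : El
    bδ = el (b * B) 0ℤ (+ 2 * b) 0ℤ

    bδ²≡ : mulQ (diagF A B C) bδ bδ ≡ scalar (b * b * D)
    bδ²≡ = solveᶜ 4 (λ A B C b → let x = coords (b :* B) :0 (con (+ 2) :* b) :0 in
          mulᶜ A B C x x ⊜ coords (b :* b :* (B :* B :- con (+ 4) :* A :* C)) :0 :0 :0)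
        (A ∷ B ∷ C ∷ b ∷ []) refl

    p∣T⇒ : + p ∣ˢ T → + p ∣ˢ a × + p ∣ˢ b
    p∣T⇒ p∣T = halve (subst (+ p ∣ˢ_) T+Bb≡2a (∣m∣n⇒∣m+n p∣T (∣n⇒∣m*n B p∣b))) , p∣b
      where
      T+Bb≡2a : T + B * b ≡ a + a
      T+Bb≡2a = ℤ-solve 3 (λ a b B → (con (+ 2) :* a :- B :* b) :+ B :* b := a :+ a) refl a b B

      bδ∈I : I bδ
      bδ∈I = subst I
        (solveᶜ 3 (λ a b B →
            (con (+ 2) ⊡ coords a :0 b :0) ⊞ coords (:- (con (+ 2) :* a :- B :* b)) :0 :0 :0 ⊜
            coords (b :* B) :0 (con (+ 2) :* b) :0)
          (a ∷ b ∷ B ∷ []) refl)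
        (I-add ((+ 2) • el a 0ℤ b 0ℤ) (scalar (- T))
          (subst I (scalar-· (+ 2) (el a 0ℤ b 0ℤ)) (I-mul (scalar (+ 2)) (el a 0ℤ b 0ℤ) s∈I))
          (I-pQ (∣⇒∣ᵉ (∣m⇒∣-m p∣T) (divides 0ℤ refl) (divides 0ℤ refl) (divides 0ℤ refl))))

      p∣b : + p ∣ˢ b
      p∣b with + p ∣? b
      ... | yes p∣b = p∣b
      -- The integer (b δ)² = b² D lies in I, which gives p ∣ D; then `I-div` puts b² D / p in I,
      -- which gives p² ∣ D.
      ... | no  p∤b = contradiction (p∣D⇒p²∣D p∣D) p²∤D
        where
        p∤b² : ¬ (+ p ∣ˢ b * b)
        p∤b² = euclid-∤ pr p∤b p∤b
        p∣D : + p ∣ˢ D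
        p∣D = euclid-∣ pr p∤b² (I∩ℤ (b * b * D) (I-mulQ bδ bδ (scalar (b * b * D)) bδ²≡ bδ∈I))
        b²D≡pb²d : ∀ d → D ≡ d * + p → b * b * D ≡ + p * (b * b * d)
        b²D≡pb²d d D≡dp = trans (cong (b * b *_) D≡dp)
          (trans (sym (ℤ.*-assoc (b * b) d (+ p))) (ℤ.*-comm (b * b * d) (+ p)))
        p∣D⇒p²∣D : + p ∣ˢ D → + p * + p ∣ˢ D
        p∣D⇒p²∣D (divides d D≡dp) = subst (+ p * + p ∣ˢ_) (sym D≡dp) (*-monoˡ-∣ (+ p) (euclid-∣ pr p∤b²
          (I∩ℤ (b * b * d) (I-divQ bδ bδ (scalar (b * b * d)) bδ∈I bδ∈I
            (trans bδ²≡ (el-cong (b²D≡pb²d d D≡dp)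
               (sym (ℤ.*-zeroʳ (+ p))) (sym (ℤ.*-zeroʳ (+ p))) (sym (ℤ.*-zeroʳ (+ p)))))))))

  -- `I∩S` is applied twice: to x², and then to x²/p, which lies in I by `I-div`.
  I∩S-square : ∀ x u v → I x → mulQ (diagF A B C) x x ≡ el u 0ℤ v 0ℤ → + p * + p ∣ˢ u × + p * + p ∣ˢ v
  I∩S-square x u v x∈I x²≡ =
    let p∣u , p∣v = I∩S u v (I-mulQ x x (el u 0ℤ v 0ℤ) x²≡ x∈I) in divide p∣u p∣v
    where
    divide : + p ∣ˢ u → + p ∣ˢ v → + p * + p ∣ˢ u × + p * + p ∣ˢ v
    divide (divides q u≡qp) (divides r v≡rp) =
      let p∣q , p∣r = I∩S q r (I-divQ x x (el q 0ℤ r 0ℤ) x∈I x∈I (trans x²≡ (el-cong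
            (trans u≡qp (ℤ.*-comm q (+ p))) (sym (ℤ.*-zeroʳ (+ p)))
            (trans v≡rp (ℤ.*-comm r (+ p))) (sym (ℤ.*-zeroʳ (+ p))))))
      in subst (+ p * + p ∣ˢ_) (sym u≡qp) (*-monoˡ-∣ (+ p) p∣q) ,
         subst (+ p * + p ∣ˢ_) (sym v≡rp) (*-monoˡ-∣ (+ p) p∣r)

  module _ (p²∤A : ¬ (+ p * + p ∣ˢ A)) (p²∤C : ¬ (+ p * + p ∣ˢ C))
           (content : ¬ (+ p ∣ˢ A × + p ∣ˢ B × + p ∣ˢ C)) where

    -- The products of t with ζ₁, ζ₃ and t are even under σ, so they lie in S, where divisibility is
    -- already known.
    I∩T : ∀ b d → I (el 0ℤ b 0ℤ d) → + p ∣ˢ b × + p ∣ˢ d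
    I∩T b d t∈I = coefficients-divisible pr p²∤A p²∤C content b d p∣bA p∣dC
      (proj₂ p²∣t²) (∣-m⇒∣m (proj₁ p²∣t²))
      where
      p∣bA : + p ∣ˢ b * A
      p∣bA = proj₂ (I∩S (- (d * A * C)) (b * A) (I-mulQ
        (el 0ℤ 1ℤ 0ℤ 0ℤ) (el 0ℤ b 0ℤ d) (el (- (d * A * C)) 0ℤ (b * A) 0ℤ)
        (solveᶜ 5 (λ A B C b d →
            mulᶜ A B C (coords :0 :1 :0 :0) (coords :0 b :0 d) ⊜
            coords (:- (d :* A :* C)) :0 (b :* A) :0)
          (A ∷ B ∷ C ∷ b ∷ d ∷ []) refl) t∈I))

      p∣dC : + p ∣ˢ d * C
      p∣dC = ∣-m⇒∣m (proj₂ (I∩S (- (b * A * C + d * B * C)) (- (d * C)) (I-mulQ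
        (el 0ℤ 0ℤ 0ℤ 1ℤ) (el 0ℤ b 0ℤ d) (el (- (b * A * C + d * B * C)) 0ℤ (- (d * C)) 0ℤ)
        (solveᶜ 5 (λ A B C b d →
            mulᶜ A B C (coords :0 :0 :0 :1) (coords :0 b :0 d) ⊜
            coords (:- (b :* A :* C :+ d :* B :* C)) :0 (:- (d :* C)) :0)
          (A ∷ B ∷ C ∷ b ∷ d ∷ []) refl) t∈I)))

      p²∣t² : + p * + p ∣ˢ - (d * C * (+ 2 * b * A + B * d)) × + p * + p ∣ˢ b * b * A - d * d * C
      p²∣t² = I∩S-square (el 0ℤ b 0ℤ d) _ _ t∈I
        (solveᶜ 5 (λ A B C b d → let t = coords :0 b :0 d in
            mulᶜ A B C t t ⊜
            coords (:- (d :* C :* (con (+ 2) :* b :* A :+ B :* d))) :0 (b :* b :* A :- d :* d :* C) :0)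
          (A ∷ B ∷ C ∷ b ∷ d ∷ []) refl)

    -- x + σ x and x lie in I, and σ is −1 on the span of ζ₁ and ζ₃.
    I⊆pQ : (∀ x → I x → I (σ x)) → ∀ x → I x → + p ∣ᵉ x
    I⊆pQ I-σ x@(el a b c d) x∈I = ∣⇒∣ᵉ p∣a (proj₁ p∣bd) p∣c (proj₂ p∣bd)
      where
      p∣2ac : + p ∣ˢ a + a × + p ∣ˢ c + c
      p∣2ac = I∩S (a + a) (c + c) (subst I
        (el-cong refl (ℤ.+-inverseʳ b) refl (ℤ.+-inverseʳ d))
        (I-add x (σ x) x∈I (I-σ x x∈I)))
      p∣a : + p ∣ˢ a
      p∣a = halve (proj₁ p∣2ac)
      p∣c : + p ∣ˢ c
      p∣c = halve (proj₂ p∣2ac)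
      p∣bd : + p ∣ˢ b × + p ∣ˢ d
      p∣bd = I∩T b d (subst I
        (el-cong (ℤ.+-inverseʳ a) (ℤ.+-identityʳ b) (ℤ.+-inverseʳ c) (ℤ.+-identityʳ d))
        (I-add x (el (- a) 0ℤ (- c) 0ℤ) x∈I
          (I-pQ (∣⇒∣ᵉ (∣m⇒∣-m p∣a) (divides 0ℤ refl) (∣m⇒∣-m p∣c) (divides 0ℤ refl)))))

-- The prime 2: a finite computation.

infix 4 _∣ᵉ?_
_∣ᵉ?_ : ∀ k x → Dec (k ∣ᵉ x)
k ∣ᵉ? el a b c d = map′ (λ (k∣a , k∣b , k∣c , k∣d) → ∣⇒∣ᵉ k∣a k∣b k∣c k∣d) ∣ᵉ⇒∣
  ((k ∣? a) ×-dec (k ∣? b) ×-dec (k ∣? c) ×-dec (k ∣? d))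

module Halving (A B C : ℤ) where

  infixl 7 _⋆_
  _⋆_ : El → El → El
  _⋆_ = mulQ (diagF A B C)

  halve? : ∀ {x} → Dec (+ 2 ∣ᵉ x) → El
  halve? {x} (yes (y , _)) = y
  halve? {x} (no _)        = x

  opaque
    -- Either outcome stays in I: x² because I is an ideal, x²/2 by `I-div`.
    step : El → El
    step x = halve? (+ 2 ∣ᵉ? (x ⋆ x))

    -- The residue fields of Q_F / 2 Q_F have 2 or 4 elements, so cubing removes the roots of unity.
    cube : El → El
    cube x = x ⋆ x ⋆ x

  -- Five rounds are enough in every admissible residue class, as `finite-check` confirms.
  obstruction : El → El
  obstruction x = cube (step (step (step (step (step x)))))

  IdempotentMod2 : El → Set
  IdempotentMod2 e = ¬ (+ 2 ∣ᵉ e) × + 2 ∣ᵉ (e ⋆ e) ⊕ (⊖ e)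

  idempotentMod2? : ∀ e → Dec (IdempotentMod2 e)
  idempotentMod2? e = ¬? (+ 2 ∣ᵉ? e) ×-dec (+ 2 ∣ᵉ? ((e ⋆ e) ⊕ (⊖ e)))

  Max₂ : Set
  Max₂ = ¬ (+ 2 ∣ A × + 2 ∣ B × + 2 ∣ C)
       × ¬ + 4 ∣ A
       × ¬ + 4 ∣ C
       × ((+ 2 ∣ A ⊎ + 2 ∣ B ⊎ + 2 ∣ C) → ¬ + 4 ∣ A + B + C)
       × ((¬ + 2 ∣ A × ¬ + 2 ∣ B × ¬ + 2 ∣ C) →
            + 4 ∣ A + B ⊎ + 4 ∣ B + C)

  max₂? : Dec Max₂
  max₂? = ¬? ((2 ℕ.∣? Z.∣ A ∣) ×-dec (2 ℕ.∣? Z.∣ B ∣) ×-dec (2 ℕ.∣? Z.∣ C ∣))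
    ×-dec ¬? (4 ℕ.∣? Z.∣ A ∣)
    ×-dec ¬? (4 ℕ.∣? Z.∣ C ∣)
    ×-dec (((2 ℕ.∣? Z.∣ A ∣) ⊎-dec (2 ℕ.∣? Z.∣ B ∣) ⊎-dec (2 ℕ.∣? Z.∣ C ∣)) →-dec ¬? (4 ℕ.∣? Z.∣ A + B + C ∣))
    ×-dec ((¬? (2 ℕ.∣? Z.∣ A ∣) ×-dec ¬? (2 ℕ.∣? Z.∣ B ∣) ×-dec ¬? (2 ℕ.∣? Z.∣ C ∣)) →-dec
             ((4 ℕ.∣? Z.∣ A + B ∣) ⊎-dec (4 ℕ.∣? Z.∣ B + C ∣)))

ι : ∀ {n} → Fin n → ℤ
ι i = + toℕ i

isZero? : ∀ (a b c d : Fin 2) → Dec (el (ι a) (ι b) (ι c) (ι d) ≡ zeroEl)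
isZero? a b c d = map′
  (λ (p , q , r , s) → el-cong p q r s) (λ eq → cong e0 eq , cong e1 eq , cong e2 eq , cong e3 eq)
  ((ι a ℤ.≟ 0ℤ) ×-dec (ι b ℤ.≟ 0ℤ) ×-dec (ι c ℤ.≟ 0ℤ) ×-dec (ι d ℤ.≟ 0ℤ))

Verdict : (i j l : Fin 4) (a b c d : Fin 2) → Set
Verdict i j l a b c d =
  x ≡ zeroEl ⊎ Halving.IdempotentMod2 (ι i) (ι j) (ι l) (Halving.obstruction (ι i) (ι j) (ι l) x)
  where
  x : El
  x = el (ι a) (ι b) (ι c) (ι d)

finite-check? : Dec (∀ i j l → Halving.Max₂ (ι i) (ι j) (ι l) → ∀ a b c d → Verdict i j l a b c d)
finite-check? = all? λ i → all? λ j → all? λ l → Halving.max₂? (ι i) (ι j) (ι l) →-dec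
  (all? λ a → all? λ b → all? λ c → all? λ d → isZero? a b c d ⊎-dec
    Halving.idempotentMod2? (ι i) (ι j) (ι l) (Halving.obstruction (ι i) (ι j) (ι l) (el (ι a) (ι b) (ι c) (ι d))))

opaque
  unfolding Halving.step

  -- Decided by evaluation over the 64 triples of coefficients mod 4 and the 16 elements mod 2.
  finite-check : ∀ i j l → Halving.Max₂ (ι i) (ι j) (ι l) → ∀ a b c d → Verdict i j l a b c d
  finite-check = toWitness {a? = finite-check?} _

-- Dependence on the coefficients modulo p².

module _ (p : ℕ) {A B C A′ B′ C′ : ℤ} where

  -- The structure constants are integral polynomials in A, B, C, so they change by multiples of p².
  mulQ-cong-mod-p² : + p * + p ∣ˢ A′ - A → + p * + p ∣ˢ B′ - B → + p * + p ∣ˢ C′ - C →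
    ∀ x y → ∃ λ v → mulQ (diagF A′ B′ C′) x y ≡ mulQ (diagF A B C) x y ⊕ ((+ p) • ((+ p) • v))
  mulQ-cong-mod-p² (divides a A≡) (divides b B≡) (divides c C≡) x@(el x0 x1 x2 x3) y@(el y0 y1 y2 y3) =
    v , trans (cong (λ F → mulQ F x y) (cong₂ (λ f g → f g) (cong₂ diagF (shift a A≡) (shift b B≡)) (shift c C≡)))
      (solveᶜ 15 (λ A B C a b c p x0 x1 x2 x3 y0 y1 y2 y3 →
         let π = p :* p
             x = coords x0 x1 x2 x3 ; y = coords y0 y1 y2 y3
             ac = :- (A :* c :+ a :* C :+ a :* c :* π)
             bc = :- (B :* c :+ b :* C :+ b :* c :* π)
             v = coords
               ((x1 :* y3 :+ x3 :* y1) :* ac :+ x2 :* y2 :* ac :+ x3 :* y3 :* bc)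
               ((x1 :* y2 :+ x2 :* y1) :* (:- b) :+ (x2 :* y3 :+ x3 :* y2) :* (:- c))
               (x1 :* y1 :* a :+ x2 :* y2 :* (:- b) :+ x3 :* y3 :* (:- c))
               ((x1 :* y2 :+ x2 :* y1) :* a)
         in mulᶜ (A :+ a :* π) (B :+ b :* π) (C :+ c :* π) x y ⊜ mulᶜ A B C x y ⊞ (p ⊡ (p ⊡ v)))
        (A ∷ B ∷ C ∷ a ∷ b ∷ c ∷ + p ∷ x0 ∷ x1 ∷ x2 ∷ x3 ∷ y0 ∷ y1 ∷ y2 ∷ y3 ∷ []) refl)
    where
    shift : ∀ q {m n} → m - n ≡ q * (+ p * + p) → m ≡ n + q * (+ p * + p)
    shift q {m} {n} eq = trans (sym (trans (ℤ.+-comm n (m - n)) (trans (ℤ.+-assoc m (- n) n)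
      (trans (cong (λ k → m + k) (ℤ.+-inverseˡ n)) (ℤ.+-identityʳ m))))) (cong (λ k → n + k) eq)
    -- The changes of - A C and - B C, divided by p².
    ac bc : ℤ
    ac = - (A * c + a * C + a * c * (+ p * + p))
    bc = - (B * c + b * C + b * c * (+ p * + p))
    v : El
    v = el ((x1 * y3 + x3 * y1) * ac + x2 * y2 * ac + x3 * y3 * bc)
           ((x1 * y2 + x2 * y1) * (- b) + (x2 * y3 + x3 * y2) * (- c))
           (x1 * y1 * a + x2 * y2 * (- b) + x3 * y3 * (- c))
           ((x1 * y2 + x2 * y1) * a)

∣-sub-comm : ∀ {k} m n → k ∣ˢ m - n → k ∣ˢ n - m
∣-sub-comm m n k∣ = subst (_ ∣ˢ_) (trans (ℤ.neg-distrib-+ m (- n))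
  (trans (ℤ.+-comm (- m) (- - n)) (cong (_- m) (ℤ.neg-involutive n)))) (∣m⇒∣-m k∣)

module _ {p : ℕ} {A B C A′ B′ C′ : ℤ}
         (A≡ : + p * + p ∣ˢ A′ - A) (B≡ : + p * + p ∣ˢ B′ - B) (C≡ : + p * + p ∣ˢ C′ - C)
         {I : El → Set} (L : LocalIdeal A B C p I) where
  open QuarticRing A B C using (_·_; ·≡mulQ)
  open QuarticRing A′ B′ C′ using () renaming (_·_ to _·′_; ·≡mulQ to ·′≡mulQ)
  open LocalIdeal L

  private
    ·-cong-mod : ∀ x y → ∃ λ v → x · y ≡ (x ·′ y) ⊕ ((+ p) • ((+ p) • v))
    ·-cong-mod x y =
      let v , eq = mulQ-cong-mod-p² p (∣-sub-comm A′ A A≡) (∣-sub-comm B′ B B≡) (∣-sub-comm C′ C C≡) x y in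
      v , trans (·≡mulQ x y) (trans eq (cong (_⊕ ((+ p) • ((+ p) • v))) (sym (·′≡mulQ x y))))

    ·′-cong-mod : ∀ x y → ∃ λ v → x ·′ y ≡ (x · y) ⊕ ((+ p) • ((+ p) • v))
    ·′-cong-mod x y =
      let v , eq = mulQ-cong-mod-p² p A≡ B≡ C≡ x y in
      v , trans (·′≡mulQ x y) (trans eq (cong (_⊕ ((+ p) • ((+ p) • v))) (sym (·≡mulQ x y))))

  -- Products change by p² v. In `I-mul` this term lies in p Q_F ⊆ I; in `I-div` the quotient w
  -- changes by p v, again in I; in `I-nil` it is absorbed into z.
  LocalIdeal-cong-mod-p² : LocalIdeal A′ B′ C′ p I
  LocalIdeal-cong-mod-p² = record
    { I-add = I-add
    ; I-mul = λ q x x∈I →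
        let v , eq = ·′-cong-mod q x in
        subst I (sym eq) (I-add (q · x) _ (I-mul q x x∈I) (I-ext ((+ p) • v)))
    ; I-ext = I-ext
    ; I-div = λ x y w x∈I y∈I xy≡pw →
        let v , eq = ·-cong-mod x y in
        subst I (⊕-cancel w ((+ p) • v)) (I-add (w ⊕ ((+ p) • v)) _
          (I-div x y (w ⊕ ((+ p) • v)) x∈I y∈I (trans eq (trans
            (cong (_⊕ ((+ p) • ((+ p) • v))) xy≡pw) (sym (•-distrib-⊕ (+ p) w ((+ p) • v))))))
          (subst I (sym (⊖-• v)) (I-ext (⊖ v))))
    ; I-nil = λ x T z x∈I x²≡ →
        let v , eq = ·-cong-mod x x in
        I-nil x T (z ⊕ ((+ p) • v)) x∈I (trans eq (trans
          (cong (_⊕ ((+ p) • ((+ p) • v))) x²≡) (trans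
          (⊕-assoc (T • x) ((+ p) • z) ((+ p) • ((+ p) • v)))
          (cong ((T • x) ⊕_) (sym (•-distrib-⊕ (+ p) z ((+ p) • v)))))))
    }
    where
    ⊖-• : ∀ v → ⊖ ((+ p) • v) ≡ (+ p) • (⊖ v)
    ⊖-• (el a b c d) = el-cong (ℤ.neg-distribʳ-* (+ p) a) (ℤ.neg-distribʳ-* (+ p) b)
                               (ℤ.neg-distribʳ-* (+ p) c) (ℤ.neg-distribʳ-* (+ p) d)

    ⊕-cancel : ∀ w u → (w ⊕ u) ⊕ (⊖ u) ≡ w
    ⊕-cancel w u = trans (⊕-assoc w u (⊖ u)) (trans
      (cong (w ⊕_) (trans (⊕-comm u (⊖ u)) (⊕-inverseˡ u))) (trans (⊕-comm w zeroEl) (⊕-identityˡ w)))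

residue : ∀ d .{{_ : ℕ.NonZero d}} → ℤ → Fin d
residue d n = fromℕ< (n%ℕd<d n d)

residue-≡ : ∀ d .{{_ : ℕ.NonZero d}} n → + d ∣ˢ n - ι (residue d n)
residue-≡ d n = divides (n /ℕ d) (begin
  n - ι (residue d n)            ≡⟨ cong (λ r → n - + r) (toℕ-fromℕ< (n%ℕd<d n d)) ⟩
  n - r                          ≡⟨ cong (_- r) (trans (a≡a%ℕn+[a/ℕn]*n n d) (ℤ.+-comm r (n /ℕ d * + d))) ⟩
  n /ℕ d * + d + r - r           ≡⟨ ℤ.+-assoc (n /ℕ d * + d) r (- r) ⟩
  n /ℕ d * + d + (r - r)         ≡⟨ cong (λ k → n /ℕ d * + d + k) (ℤ.+-inverseʳ r) ⟩
  n /ℕ d * + d + 0ℤ              ≡⟨ ℤ.+-identityʳ _ ⟩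
  n /ℕ d * + d                   ∎)
  where
  open ≡-Reasoning
  r : ℤ
  r = + (n %ℕ d)

∣-resp-≡ : ∀ {k d} m n → d ∣ˢ m - n → k ∣ˢ d → k ∣ˢ m → k ∣ˢ n
∣-resp-≡ {k} m n d∣m-n k∣d k∣m = subst (k ∣ˢ_) (m-[m-n]≡n m n) (∣m∣n⇒∣m-n k∣m (∣-trans k∣d d∣m-n))
  where
  m-[m-n]≡n : ∀ m n → m - (m - n) ≡ n
  m-[m-n]≡n = ℤ-solve 2 (λ m n → m :- (m :- n) := n) refl

+-cong-∣ : ∀ {k} m m′ n n′ → k ∣ˢ m - m′ → k ∣ˢ n - n′ → k ∣ˢ m + n - (m′ + n′)
+-cong-∣ m m′ n n′ k∣ k∣′ = subst (_ ∣ˢ_)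
  (ℤ-solve 4 (λ m m′ n n′ → (m :- m′) :+ (n :- n′) := m :+ n :- (m′ :+ n′)) refl m m′ n n′)
  (∣m∣n⇒∣m+n k∣ k∣′)

-‿cong-∣ : ∀ {k} m m′ n n′ → k ∣ˢ m - m′ → k ∣ˢ n - n′ → k ∣ˢ m - n - (m′ - n′)
-‿cong-∣ m m′ n n′ k∣ k∣′ = subst (_ ∣ˢ_)
  (ℤ-solve 4 (λ m m′ n n′ → (m :- m′) :- (n :- n′) := m :- n :- (m′ :- n′)) refl m m′ n n′)
  (∣m∣n⇒∣m-n k∣ k∣′)

-- Odd integers are ±1 mod 4; the statement is decided on pairs of residues.
odd⇒4∣+⊎4∣- : ∀ m n → ¬ (+ 2 ∣ˢ m) → ¬ (+ 2 ∣ˢ n) → + 4 ∣ˢ m + n ⊎ + 4 ∣ˢ m - n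
odd⇒4∣+⊎4∣- m n 2∤m 2∤n =
  [ (λ 2∣i → contradiction (∣-resp-≡ (ι i) m i≡m (divides (+ 2) refl) 2∣i) 2∤m)
  , [ (λ 2∣j → contradiction (∣-resp-≡ (ι j) n j≡n (divides (+ 2) refl) 2∣j) 2∤n)
    , Sum.map (∣-resp-≡ (ι i + ι j) (m + n) (+-cong-∣ (ι i) m (ι j) n i≡m j≡n) ∣-refl)
              (∣-resp-≡ (ι i - ι j) (m - n) (-‿cong-∣ (ι i) m (ι j) n i≡m j≡n) ∣-refl) ]′ ]′
  (residues i j)
  where
  i j : Fin 4
  i = residue 4 m
  j = residue 4 n
  i≡m : + 4 ∣ˢ ι i - m
  i≡m = ∣-sub-comm m (ι i) (residue-≡ 4 m)
  j≡n : + 4 ∣ˢ ι j - n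
  j≡n = ∣-sub-comm n (ι j) (residue-≡ 4 n)
  residues : ∀ (i j : Fin 4) → + 2 ∣ˢ ι i ⊎ + 2 ∣ˢ ι j ⊎ + 4 ∣ˢ ι i + ι j ⊎ + 4 ∣ˢ ι i - ι j
  residues = toWitness {a? = all? λ (i : Fin 4) → all? λ (j : Fin 4) →
    (+ 2 ∣? ι i) ⊎-dec (+ 2 ∣? ι j) ⊎-dec (+ 4 ∣? ι i + ι j) ⊎-dec (+ 4 ∣? ι i - ι j)} _

module _ (A B C A′ B′ C′ : ℤ) (A≡ : + 4 ∣ˢ A - A′) (B≡ : + 4 ∣ˢ B - B′) (C≡ : + 4 ∣ˢ C - C′) where

  Max₂-cong-mod-4 : Halving.Max₂ A B C → Halving.Max₂ A′ B′ C′
  Max₂-cong-mod-4 (content , 4∤A , 4∤C , 4∤A+B+C , odd) =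
    (λ (2∣A′ , 2∣B′ , 2∣C′) → content (2∣⇐ A A′ A≡ 2∣A′ , 2∣⇐ B B′ B≡ 2∣B′ , 2∣⇐ C C′ C≡ 2∣C′)) ,
    (λ 4∣A′ → 4∤A (4∣⇐ A A′ A≡ 4∣A′)) ,
    (λ 4∣C′ → 4∤C (4∣⇐ C C′ C≡ 4∣C′)) ,
    (λ even 4∣ → 4∤A+B+C
      (Sum.map (2∣⇐ A A′ A≡) (Sum.map (2∣⇐ B B′ B≡) (2∣⇐ C C′ C≡)) even)
      (4∣⇐ (A + B + C) (A′ + B′ + C′) (+-cong-∣ (A + B) (A′ + B′) C C′ (+-cong-∣ A A′ B B′ A≡ B≡) C≡) 4∣)) ,
    (λ (2∤A′ , 2∤B′ , 2∤C′) → Sum.map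
      (4∣⇒ (A + B) (A′ + B′) (+-cong-∣ A A′ B B′ A≡ B≡))
      (4∣⇒ (B + C) (B′ + C′) (+-cong-∣ B B′ C C′ B≡ C≡))
      (odd ((λ 2∣A → 2∤A′ (2∣⇒ A A′ A≡ 2∣A)) , (λ 2∣B → 2∤B′ (2∣⇒ B B′ B≡ 2∣B)) , (λ 2∣C → 2∤C′ (2∣⇒ C C′ C≡ 2∣C)))))
    where
    4∣⇒ : ∀ m n → + 4 ∣ˢ m - n → + 4 ∣ m → + 4 ∣ n
    4∣⇒ m n m≡n 4∣m = ∣⇒∣ᵤ (∣-resp-≡ {k = + 4} m n m≡n (divides 1ℤ refl) (∣ᵤ⇒∣ 4∣m))

    2∣⇒ : ∀ m n → + 4 ∣ˢ m - n → + 2 ∣ m → + 2 ∣ n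
    2∣⇒ m n m≡n 2∣m = ∣⇒∣ᵤ (∣-resp-≡ {k = + 2} m n m≡n (divides (+ 2) refl) (∣ᵤ⇒∣ 2∣m))

    4∣⇐ : ∀ m n → + 4 ∣ˢ m - n → + 4 ∣ n → + 4 ∣ m
    4∣⇐ m n m≡n = 4∣⇒ n m (∣-sub-comm m n m≡n)

    2∣⇐ : ∀ m n → + 4 ∣ˢ m - n → + 2 ∣ n → + 2 ∣ m
    2∣⇐ m n m≡n = 2∣⇒ n m (∣-sub-comm m n m≡n)

-- The prime 2: I ⊆ 2 Q_F.

module _ {A B C : ℤ} {I : El → Set} (L : LocalIdeal A B C 2 I) where
  open LocalIdeal L
  open LocalIdealProperties L
  open Halving A B C

  opaque
    unfolding Halving.step

    I-step : ∀ x → I x → I (step x)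
    I-step x x∈I = halved (+ 2 ∣ᵉ? (x ⋆ x))
      where
      halved : (2∣x² : Dec (+ 2 ∣ᵉ x ⋆ x)) → I (halve? 2∣x²)
      halved (yes (y , x²≡2y)) = I-divQ x x y x∈I x∈I x²≡2y
      halved (no _)            = I-mulQ x x (x ⋆ x) refl x∈I

    I-cube : ∀ x → I x → I (cube x)
    I-cube x x∈I = I-mulQ (x ⋆ x) x (cube x) refl x∈I

  I-obstruction : ∀ x → I x → I (obstruction x)
  I-obstruction x x∈I = I-cube _ (I-step _ (I-step _ (I-step _ (I-step _ (I-step x x∈I)))))

  -- An idempotent mod 2 satisfies the relation of `I-nil` with T = 1, which is odd.
  I-no-idempotent : ∀ e → I e → ¬ IdempotentMod2 e
  I-no-idempotent e e∈I (2∤e , z , e²-e≡2z) = [ 2∤1 , 2∤e ]′ (I-nilQ e 1ℤ z e∈I (begin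
    e ⋆ e                          ≡⟨ ⊕-identityˡ (e ⋆ e) ⟨
    zeroEl ⊕ (e ⋆ e)               ≡⟨ cong (_⊕ (e ⋆ e)) (trans (⊕-comm e (⊖ e)) (⊕-inverseˡ e)) ⟨
    (e ⊕ (⊖ e)) ⊕ (e ⋆ e)          ≡⟨ ⊕-assoc e (⊖ e) (e ⋆ e) ⟩
    e ⊕ ((⊖ e) ⊕ (e ⋆ e))          ≡⟨ cong (e ⊕_) (trans (⊕-comm (⊖ e) (e ⋆ e)) e²-e≡2z) ⟩
    e ⊕ ((+ 2) • z)                ≡⟨ cong (_⊕ ((+ 2) • z)) (•-identity e) ⟨
    (1ℤ • e) ⊕ ((+ 2) • z)         ∎))
    where open ≡-Reasoning

I-residues : ∀ {I} i j l a b c d → LocalIdeal (ι i) (ι j) (ι l) 2 I → Halving.Max₂ (ι i) (ι j) (ι l) →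
  I (el (ι a) (ι b) (ι c) (ι d)) → el (ι a) (ι b) (ι c) (ι d) ≡ zeroEl
I-residues i j l a b c d L max x∈I = [ id , (λ idempotent → contradiction idempotent
    (I-no-idempotent L _ (I-obstruction L (el (ι a) (ι b) (ι c) (ι d)) x∈I))) ]′
  (finite-check i j l max a b c d)

-- The coefficients may be replaced by their residues mod 4 = 2², and x by its residue mod 2 because
-- 2 Q_F ⊆ I; this leaves the finitely many cases already checked.
I⊆2Q : ∀ {A B C I} → LocalIdeal A B C 2 I → Halving.Max₂ A B C → ∀ x → I x → + 2 ∣ᵉ x
I⊆2Q {A} {B} {C} {I} L max x@(el x0 x1 x2 x3) x∈I =
  even (I-residues i j l (residue 2 x0) (residue 2 x1) (residue 2 x2) (residue 2 x3) L′
    (Max₂-cong-mod-4 A B C (ι i) (ι j) (ι l) (residue-≡ 4 A) (residue-≡ 4 B) (residue-≡ 4 C) max) r∈I)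
  where
  i j l : Fin 4
  i = residue 4 A
  j = residue 4 B
  l = residue 4 C

  L′ : LocalIdeal (ι i) (ι j) (ι l) 2 I
  L′ = LocalIdeal-cong-mod-p² (∣-sub-comm A (ι i) (residue-≡ 4 A)) (∣-sub-comm B (ι j) (residue-≡ 4 B))
         (∣-sub-comm C (ι l) (residue-≡ 4 C)) L

  r : El
  r = el (ι (residue 2 x0)) (ι (residue 2 x1)) (ι (residue 2 x2)) (ι (residue 2 x3))

  r∈I : I r
  r∈I = subst I
    (el-cong (cancel x0 (ι (residue 2 x0))) (cancel x1 (ι (residue 2 x1)))
             (cancel x2 (ι (residue 2 x2))) (cancel x3 (ι (residue 2 x3))))
    (LocalIdeal.I-add L x r-x x∈I (LocalIdealProperties.I-pQ L (∣⇒∣ᵉ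
      (2∣r-x x0) (2∣r-x x1) (2∣r-x x2) (2∣r-x x3))))
    where
    r-x : El
    r-x = el (ι (residue 2 x0) - x0) (ι (residue 2 x1) - x1) (ι (residue 2 x2) - x2) (ι (residue 2 x3) - x3)
    2∣r-x : ∀ n → + 2 ∣ˢ ι (residue 2 n) - n
    2∣r-x n = ∣-sub-comm n (ι (residue 2 n)) (residue-≡ 2 n)
    cancel : ∀ m n → m + (n - m) ≡ n
    cancel = ℤ-solve 2 (λ m n → m :+ (n :- m) := n) refl

  even : r ≡ zeroEl → + 2 ∣ᵉ x
  even r≡0 = ∣⇒∣ᵉ (2∣ x0 (cong e0 r≡0)) (2∣ x1 (cong e1 r≡0)) (2∣ x2 (cong e2 r≡0)) (2∣ x3 (cong e3 r≡0))
    where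
    2∣ : ∀ n → ι (residue 2 n) ≡ 0ℤ → + 2 ∣ˢ n
    2∣ n r≡0 = subst (+ 2 ∣ˢ_) (trans (cong (λ k → n - k) r≡0) (ℤ.+-identityʳ n)) (residue-≡ 2 n)

-- Maximality and the final equivalences.

¬Overring-0 : ∀ {F p} → ¬ Overring F p 0
¬Overring-0 R = let x , _ , x∉Q = Overring.M-proper R in x∉Q (x , sym (•-identity x))

-- An exponent 0 allows no proper overring, so exponents may be taken of the form k + 1, as the
-- definition of I through πᵏ requires.
maximalAt : ∀ {F p} → (∀ k → ¬ Overring F p (suc k)) → MaximalAt F p
maximalAt none (zero  , R) = ¬Overring-0 R
maximalAt none (suc k , R) = none k R

odd⇒maximal : ∀ {A B C p} → Prime p → ¬ (+ p ∣ˢ + 2) → ¬ (+ p ∣ˢ A × + p ∣ˢ B × + p ∣ˢ C) →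
  ¬ (+ p * + p ∣ˢ A) → ¬ (+ p * + p ∣ˢ C) → ¬ (+ p * + p ∣ˢ B * B - + 4 * A * C) →
  MaximalAt (diagF A B C) p
odd⇒maximal {A} {B} {C} {p} pr p∤2 content p²∤A p²∤C p²∤D = maximalAt λ k R →
  -- The doubled exponent `suc k +ℕ suc k` reduces to `suc (k +ℕ suc k)`.
  FromOverring.I⊆pQ⇒⊥ pr (k +ℕ suc k) (Symmetrise.overring R)
    (OddPrime.I⊆pQ pr p∤2 (FromOverring.localIdeal pr (k +ℕ suc k) (Symmetrise.overring R)) p²∤D p²∤A p²∤C content
      (FromOverring.I-stable pr (k +ℕ suc k) (Symmetrise.overring R) σ σ-• (Symmetrise.compositum-σ R)))
  where
  instance
    p≢0 : ℕ.NonZero p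
    p≢0 = prime⇒nonZero pr

Max₂⇒maximal : ∀ {A B C} → Halving.Max₂ A B C → MaximalAt (diagF A B C) 2
Max₂⇒maximal max = maximalAt λ k R →
  FromOverring.I⊆pQ⇒⊥ prime[2] k R (I⊆2Q (FromOverring.localIdeal prime[2] k R) max)

theorem4p1 : (A B C : ℤ) →
    ((p : ℕ) → Prime p → p ≢ 2 →
    MaximalAt (diagF A B C) p ⇔
    (¬ ((+ p) ∣ A × (+ p) ∣ B × (+ p) ∣ C)
    × ¬ (+ (p *ℕ p)) ∣ A
    × ¬ (+ (p *ℕ p)) ∣ C
    × ¬ (+ (p *ℕ p)) ∣ (B * B - + 4 * A * C)))
    ×
    (MaximalAt (diagF A B C) 2 ⇔
    (¬ ((+ 2) ∣ A × (+ 2) ∣ B × (+ 2) ∣ C)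
    × ¬ (+ 4) ∣ A
    × ¬ (+ 4) ∣ C
    × (((+ 2) ∣ A ⊎ (+ 2) ∣ B ⊎ (+ 2) ∣ C) → ¬ (+ 4) ∣ (A + B + C))
    × ((¬ (+ 2) ∣ A × ¬ (+ 2) ∣ B × ¬ (+ 2) ∣ C) →
    (+ 4) ∣ (A + B) ⊎ (+ 4) ∣ (B + C))))
theorem4p1 A B C = odd , mk⇔ two-⇒ Max₂⇒maximal
  where
  odd : (p : ℕ) → Prime p → p ≢ 2 → _ ⇔ _
  odd p pr p≢2 = mk⇔
    (λ max →
      (λ (p∣A , p∣B , p∣C) → max (content⇒nonMaximal A B C p p∤1 (∣ᵤ⇒∣ p∣A) (∣ᵤ⇒∣ p∣B) (∣ᵤ⇒∣ p∣C))) ,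
      (λ p²∣A → max (p²∣A⇒nonMaximal A B C p p∤1 (toˢ p²∣A))) ,
      (λ p²∣C → max (p²∣C⇒nonMaximal A B C p p∤1 (toˢ p²∣C))) ,
      (λ p²∣D → max (p²∣D⇒nonMaximal A B C p p∤1 p∤2 (toˢ p²∣D))))
    (λ (content , p²∤A , p²∤C , p²∤D) → odd⇒maximal pr p∤2
      (λ (p∣A , p∣B , p∣C) → content (∣⇒∣ᵤ p∣A , ∣⇒∣ᵤ p∣B , ∣⇒∣ᵤ p∣C))
      (λ p²∣A → p²∤A (toᵘ p²∣A)) (λ p²∣C → p²∤C (toᵘ p²∣C)) (λ p²∣D → p²∤D (toᵘ p²∣D)))
    where
    p∤1 : ¬ (+ p ∣ˢ 1ℤ)
    p∤1 p∣1 = ¬prime[1] (subst Prime (ℕ.∣1⇒≡1 (∣⇒∣ᵤ p∣1)) pr)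
    p∤2 : ¬ (+ p ∣ˢ + 2)
    p∤2 p∣2 = [ (λ { refl → ¬prime[1] pr }) , p≢2 ]′ (prime⇒irreducible prime[2] (∣⇒∣ᵤ p∣2))
    toˢ : ∀ {n} → + (p *ℕ p) ∣ n → + p * + p ∣ˢ n
    toˢ {n} p²∣n = subst (_∣ˢ n) (ℤ.pos-* p p) (∣ᵤ⇒∣ p²∣n)
    toᵘ : ∀ {n} → + p * + p ∣ˢ n → + (p *ℕ p) ∣ n
    toᵘ {n} p²∣n = ∣⇒∣ᵤ (subst (_∣ˢ n) (sym (ℤ.pos-* p p)) p²∣n)

  two-⇒ : MaximalAt (diagF A B C) 2 → Halving.Max₂ A B C
  two-⇒ max =
    (λ (2∣A , 2∣B , 2∣C) → max (content⇒nonMaximal A B C 2 2∤1 (∣ᵤ⇒∣ 2∣A) (∣ᵤ⇒∣ 2∣B) (∣ᵤ⇒∣ 2∣C))) ,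
    (λ 4∣A → max (p²∣A⇒nonMaximal A B C 2 2∤1 (∣ᵤ⇒∣ 4∣A))) ,
    (λ 4∣C → max (p²∣C⇒nonMaximal A B C 2 2∤1 (∣ᵤ⇒∣ 4∣C))) ,
    (λ _ 4∣A+B+C → max (4∣A+B+C⇒nonMaximal A B C (∣ᵤ⇒∣ 4∣A+B+C))) ,
    all-odd
    where
    4∣? : ∀ m n → ¬ + 2 ∣ m → ¬ + 2 ∣ n → + 4 ∣ˢ m + n ⊎ + 4 ∣ˢ m - n
    4∣? m n 2∤m 2∤n = odd⇒4∣+⊎4∣- m n (λ 2∣m → 2∤m (∣⇒∣ᵤ 2∣m)) (λ 2∣n → 2∤n (∣⇒∣ᵤ 2∣n))
    all-odd : ¬ + 2 ∣ A × ¬ + 2 ∣ B × ¬ + 2 ∣ C →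
              + 4 ∣ A + B ⊎ + 4 ∣ B + C
    all-odd (2∤A , 2∤B , 2∤C) =
      -- If neither sum is divisible by 4, the odd numbers A, B, C are all congruent mod 4.
      [ (λ 4∣A+B → inj₁ (∣⇒∣ᵤ 4∣A+B))
      , (λ 4∣A-B → [ (λ 4∣B+C → inj₂ (∣⇒∣ᵤ 4∣B+C))
                   , (λ 4∣B-C → ⊥-elim (max (A≡B≡C⇒nonMaximal A B C 4∣A-B
                       (subst (+ 4 ∣ˢ_) (ℤ-solve 3 (λ A B C → (A :- B) :+ (B :- C) := A :- C) refl A B C)
                         (∣m∣n⇒∣m+n 4∣A-B 4∣B-C))))) ]′ (4∣? B C 2∤B 2∤C)) ]′ (4∣? A B 2∤A 2∤B)
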